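{- There exist a computable function $f$ and an algorithm that, given an instance $(V,\mathcal{G})$ of $k$-\textsc{Compatible Ordering} together with a labeled modular decomposition of the labeled union of $\mathcal{G}$ of labeled modular width $mw$, decides the instance in time $f(k+mw)\cdot |V|^{\mathcal{O}(1)}$. In particular, the problem is solvable in polynomial time when $k+mw$ is bounded by a constant.
   Context: For a positive integer $k$, write $[k]=\{1,\dots,k\}$. An instance of $k$-\textsc{Compatible Ordering} consists of a finite vertex set $V$ with $n=|V|$ and a collection $\mathcal{G}$ of $k$ pairs of directed graphs $(A_1,B_1),\dots,(A_k,B_k)$ with $V(A_i)=V(B_i)=V$ for all $i\in[k]$. The instance is a yes-instance if and only if there exist an ordering $s_1,\dots,s_n$ of $V$ and labels $\ell_1,\dots,\ell_n\in[k]$ such that for every $i\in[n]$: (i) $s_i$ has no out-neighbor in $A_{\ell_i}$ among $s_{i+1},\dots,s_n$, and (ii) $s_i$ has no in-neighbor in $B_{\ell_i}$ among $s_1,\dots,s_{i-1}$. The labeled union of $\mathcal{G}$ is the directed graph on $V$ whose arcs are all arcs of the $A_i,B_i$, where each arc $uv$ carries the label set $L(uv)\subseteq\{\text{"}A_1\text{"},\text{"}B_1\text{"},\dots,\text{"}A_k\text{"},\text{"}B_k\text{"}\}$ of those graphs that contain $uv$. A labeled directed graph is one whose arcs carry such label sets. Consider the operations: (O1) create a single isolated vertex; (O2) disjoint union of two labeled directed graphs; (O3) labeled complete join of labeled directed graphs $G_1=(V_1,E_1)$, $G_2=(V_2,E_2)$: the graph on $V_1\cup V_2$ with arcs $E_1\cup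 E_2$ together with, for a fixed label set $L$, all arcs $(uv,L)$ with $u\in V_1,v\in V_2$, and/or for a fixed label set $L'$, all arcs $(vu,L')$ with $u\in V_1, v\in V_2$ (at least one of these two families nonempty); (O4) labeled substitution: given labeled directed graphs $G_1,\dots,G_p$ on pairwise disjoint vertex sets and a labeled directed template graph $G_t$ on vertices $v_1,\dots,v_p$, form the graph on $\bigcup_i V(G_i)$ whose arcs are those of all $G_i$ together with, for each arc $(v_xv_y,L)$ of $G_t$, all arcs $(u_iu_j,L)$ with $u_i\in V(G_x)$, $u_j\in V(G_y)$. A labeled modular decomposition of a labeled directed graph $G$ is an expression constructing $G$ from these operations; its width is the maximum number $p$ of operands used in a substitution operation, and the labeled modular width of $G$ is the minimum width over all its labeled modular decompositions. -}

module Defs where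

open import Data.Bool using (Bool; true; false; T; if_then_else_)
open import Data.Fin as Fin using (Fin; toℕ)
open import Data.Fin.Permutation using (Permutation′; _⟨$⟩ʳ_)
open import Data.Fin.Subset using (Subset)
open import Data.Fin.Subset.Properties using (nonempty?)
open import Data.List as List using (List; []; _∷_)
open import Data.List.Extrema.Nat using (max)
open import Data.Maybe using (Maybe; just; nothing)
open import Data.Nat using (ℕ; zero; suc; _+_; _≤_; _⊔_)
open import Data.Product using (Σ; ∃-syntax; _×_; _,_)
open import Data.Sum using (_⊎_; inj₁; inj₂)
open import Data.These using (These; fromThis; fromThat)
open import Data.Unit using (⊤; tt)
open import Data.Vec as Vec using (Vec; []; _∷_)
open import Function using (_∘_; _↔_; _⇔_; Inverse)
open import Relation.Binary.PropositionalEquality using (_≡_; refl)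
open import Relation.Nullary using (¬_; yes; no)
open import Relation.Nullary.Decidable using (does; _⊎-dec_)

------------------------------------------------------------------------
-- Compatible orderings

Digraph : ℕ → Set
Digraph n = Fin n → Fin n → Bool

record Instance (k n : ℕ) : Set where
  field
    A B : Fin k → Digraph n

record CompatibleOrdering {k n} (I : Instance k n) : Set where
  open Instance I
  field
    ordering : Permutation′ n
    label    : Fin n → Fin k      -- indexed by position, not by vertex

  s : Fin n → Fin n
  s i = ordering ⟨$⟩ʳ i

  field
    noLaterOut  : ∀ i j → i Fin.< j → ¬ T (A (label i) (s i) (s j))
    noEarlierIn : ∀ i j → j Fin.< i → ¬ T (B (label i) (s j) (s i))

------------------------------------------------------------------------
-- Labeled directed graphs

-- The pair (a , b) stands for { "A_i" | i ∈ a } ∪ { "B_i" | i ∈ b }.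
LabelSet : ℕ → Set
LabelSet k = Subset k × Subset k

-- arc u v is nothing if there is no arc uv, and just L if there is one
-- with label set L.
record LabeledDigraph (k : ℕ) : Set₁ where
  field
    V   : Set
    arc : V → V → Maybe (LabelSet k)

labeledUnion : ∀ {k n} → Instance k n → LabeledDigraph k
labeledUnion {k} {n} I = record
  { V   = Fin n
  ; arc = λ u v →
      let a = Vec.tabulate (λ i → A i u v)
          b = Vec.tabulate (λ i → B i u v)
      in if does (nonempty? a ⊎-dec nonempty? b) then just (a , b) else nothing
  }
  where open Instance I

------------------------------------------------------------------------
-- Labeled modular decompositions

-- Substitution takes at least two operands and a template without loops.
-- A substitution with one operand would return that operand, so
-- expressions could be padded to a length unbounded in the number of
-- vertices.
data Expr (k : ℕ) : Set where
  vertex     : Expr k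
  union      : Expr k → Expr k → Expr k
  join       : These (LabelSet k) (LabelSet k) → Expr k → Expr k → Expr k
  substitute : ∀ {p} → 2 ≤ p →
               (t : Fin p → Fin p → Maybe (LabelSet k)) →
               (∀ x → t x x ≡ nothing) →
               (Fin p → Expr k) → Expr k

open LabeledDigraph

Vertex : ∀ {k} → Expr k → Set
Vertex vertex                    = ⊤
Vertex (union e₁ e₂)             = Vertex e₁ ⊎ Vertex e₂
Vertex (join _ e₁ e₂)            = Vertex e₁ ⊎ Vertex e₂
Vertex (substitute {p} _ _ _ es) = Σ (Fin p) (Vertex ∘ es)

arcs : ∀ {k} (e : Expr k) → Vertex e → Vertex e → Maybe (LabelSet k)
arcs vertex         _        _        = nothing
arcs (union e₁ e₂)  (inj₁ u) (inj₁ v) = arcs e₁ u v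
arcs (union e₁ e₂)  (inj₂ u) (inj₂ v) = arcs e₂ u v
arcs (union e₁ e₂)  (inj₁ u) (inj₂ v) = nothing
arcs (union e₁ e₂)  (inj₂ u) (inj₁ v) = nothing
arcs (join L e₁ e₂) (inj₁ u) (inj₁ v) = arcs e₁ u v
arcs (join L e₁ e₂) (inj₂ u) (inj₂ v) = arcs e₂ u v
arcs (join L e₁ e₂) (inj₁ u) (inj₂ v) = fromThis L
arcs (join L e₁ e₂) (inj₂ u) (inj₁ v) = fromThat L
arcs (substitute _ t _ es) (x , u) (y , v) with x Fin.≟ y
... | yes refl = arcs (es x) u v
... | no  _    = t x y

⟦_⟧ : ∀ {k} → Expr k → LabeledDigraph k
⟦ e ⟧ = record { V = Vertex e ; arc = arcs e }

width : ∀ {k} → Expr k → ℕ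
width vertex                    = 0
width (union e₁ e₂)             = width e₁ ⊔ width e₂
width (join _ e₁ e₂)            = width e₁ ⊔ width e₂
width (substitute {p} _ _ _ es) = max p (List.tabulate (width ∘ es))

-- Vertex sets of expressions are disjoint sums of abstract points; the
-- bijection says which vertex of G each of the points is.
record Decomposition {k} (G : LabeledDigraph k) : Set where
  field
    expr     : Expr k
    vertices : V ⟦ expr ⟧ ↔ V G

  name : V ⟦ expr ⟧ → V G
  name = Inverse.to vertices

  field
    arcs-agree : ∀ u v → arc ⟦ expr ⟧ u v ≡ arc G (name u) (name v)

decompositionWidth : ∀ {k} {G : LabeledDigraph k} → Decomposition G → ℕ
decompositionWidth = width ∘ Decomposition.expr

------------------------------------------------------------------------
-- Model of computation

-- First-order recursive programs over binary trees, in the style of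
-- Jones' languages F and WHILE ("Computability and Complexity from a
-- Programming Perspective").  Every evaluated subexpression costs one
-- unit.  Trees can be shared and are only inspected one constructor at a
-- time, so with trees represented by pointers each unit is a bounded
-- number of machine operations: the cost is polynomially related to
-- Turing machine time.

infixr 5 _∙_

data Tree : Set where
  nil : Tree
  _∙_ : Tree → Tree → Tree

-- Expressions with j variables over m function symbols of given arities.
data Term {m} (arity : Fin m → ℕ) (j : ℕ) : Set where
  var   : Fin j → Term arity j
  nil   : Term arity j
  _∙_   : Term arity j → Term arity j → Term arity j
  case  : Term arity j → Term arity j → Term arity (2 + j) → Term arity j
  bind  : Term arity j → Term arity (1 + j) → Term arity j
  call  : (g : Fin m) → Vec (Term arity j) (arity g) → Term arity j

record Program : Set where
  field
    {functions} : ℕ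
    arity       : Fin functions → ℕ
    body        : (g : Fin functions) → Term arity (arity g)
    main        : Term arity 1

module Semantics (P : Program) where
  open Program P

  infix 4 _⊢_⇓_cost_ _⊢*_⇓_cost_

  mutual
    -- Call-by-value evaluation in an environment.
    data _⊢_⇓_cost_ {j} (ρ : Vec Tree j) : Term arity j → Tree → ℕ → Set where
      var       : ∀ x → ρ ⊢ var x ⇓ Vec.lookup ρ x cost 1
      nil       : ρ ⊢ nil ⇓ nil cost 1
      _∙_       : ∀ {e₁ e₂ v₁ v₂ c₁ c₂} →
                  ρ ⊢ e₁ ⇓ v₁ cost c₁ → ρ ⊢ e₂ ⇓ v₂ cost c₂ →
                  ρ ⊢ e₁ ∙ e₂ ⇓ v₁ ∙ v₂ cost suc (c₁ + c₂)
      case-nil  : ∀ {e e₁ e₂ v c c₁} →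
                  ρ ⊢ e ⇓ nil cost c → ρ ⊢ e₁ ⇓ v cost c₁ →
                  ρ ⊢ case e e₁ e₂ ⇓ v cost suc (c + c₁)
      case-cons : ∀ {e e₁ e₂ x y v c c₂} →
                  ρ ⊢ e ⇓ x ∙ y cost c → x ∷ y ∷ ρ ⊢ e₂ ⇓ v cost c₂ →
                  ρ ⊢ case e e₁ e₂ ⇓ v cost suc (c + c₂)
      bind      : ∀ {e₁ e₂ v₁ v₂ c₁ c₂} →
                  ρ ⊢ e₁ ⇓ v₁ cost c₁ → v₁ ∷ ρ ⊢ e₂ ⇓ v₂ cost c₂ →
                  ρ ⊢ bind e₁ e₂ ⇓ v₂ cost suc (c₁ + c₂)
      call      : ∀ {g es vs v c c′} →
                  ρ ⊢* es ⇓ vs cost c → vs ⊢ body g ⇓ v cost c′ →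
                  ρ ⊢ call g es ⇓ v cost suc (c + c′)

    data _⊢*_⇓_cost_ {j} (ρ : Vec Tree j) :
           ∀ {i} → Vec (Term arity j) i → Vec Tree i → ℕ → Set where
      []  : ρ ⊢* [] ⇓ [] cost 0
      _∷_ : ∀ {i e v c c′} {es : Vec (Term arity j) i} {vs} →
            ρ ⊢ e ⇓ v cost c → ρ ⊢* es ⇓ vs cost c′ →
            ρ ⊢* e ∷ es ⇓ v ∷ vs cost (c + c′)

Run : Program → Tree → Tree → ℕ → Set
Run P x y t = x ∷ [] ⊢ Program.main P ⇓ y cost t
  where open Semantics P

------------------------------------------------------------------------
-- Encodings

encodeℕ : ℕ → Tree
encodeℕ zero    = nil
encodeℕ (suc m) = nil ∙ encodeℕ m

encodeBool : Bool → Tree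
encodeBool false = nil
encodeBool true  = nil ∙ nil

encodeList : List Tree → Tree
encodeList []       = nil
encodeList (x ∷ xs) = x ∙ encodeList xs

encodeMaybe : ∀ {X : Set} → (X → Tree) → Maybe X → Tree
encodeMaybe enc nothing  = nil
encodeMaybe enc (just x) = nil ∙ enc x

encodeMatrix : ∀ {X : Set} {m} → (X → Tree) → (Fin m → Fin m → X) → Tree
encodeMatrix enc M =
  encodeList (List.tabulate λ i → encodeList (List.tabulate λ j → enc (M i j)))

encodeSubset : ∀ {k} → Subset k → Tree
encodeSubset = encodeList ∘ List.map encodeBool ∘ Vec.toList

encodeLabelSet : ∀ {k} → LabelSet k → Tree
encodeLabelSet (a , b) = encodeSubset a ∙ encodeSubset b

encodeInstance : ∀ {k n} → Instance k n → Tree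
encodeInstance {k} {n} I =
  encodeℕ k ∙ encodeℕ n ∙
  encodeList (List.tabulate λ i →
    encodeMatrix encodeBool (A i) ∙ encodeMatrix encodeBool (B i))
  where open Instance I

encodeExpr : ∀ {k} (e : Expr k) → (Vertex e → ℕ) → Tree
encodeExpr vertex name = encodeℕ 0 ∙ encodeℕ (name tt)
encodeExpr (union e₁ e₂) name =
  encodeℕ 1 ∙ encodeExpr e₁ (name ∘ inj₁) ∙ encodeExpr e₂ (name ∘ inj₂)
encodeExpr (join L e₁ e₂) name =
  encodeℕ 2 ∙
  (encodeMaybe encodeLabelSet (fromThis L) ∙ encodeMaybe encodeLabelSet (fromThat L)) ∙
  encodeExpr e₁ (name ∘ inj₁) ∙ encodeExpr e₂ (name ∘ inj₂)
encodeExpr (substitute {p} _ t _ es) name =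
  encodeℕ 3 ∙ encodeℕ p ∙
  encodeMatrix (encodeMaybe encodeLabelSet) t ∙
  encodeList (List.tabulate λ x → encodeExpr (es x) (λ u → name (x , u)))

encodeInput : ∀ {k n} (I : Instance k n) → Decomposition (labeledUnion I) → Tree
encodeInput I D = encodeInstance I ∙ encodeExpr expr (toℕ ∘ name)
  where open Decomposition D

------------------------------------------------------------------------
-- Computability and running time

Computable : (ℕ → ℕ) → Set
Computable f = ∃[ P ] (∀ m → ∃[ t ] Run P (encodeℕ m) (encodeℕ (f m)) t)

-- On input x, P answers correctly whether Q holds within the given time.
DecidesWithin : Program → Tree → Set → ℕ → Set
DecidesWithin P x Q bound =
  ∃[ b ] ∃[ t ] Run P x (encodeBool b) t × t ≤ bound × (Q ⇔ T b)

{-# OPTIONS --safe #-}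

-- Write an ordering with its labels as a list of pairs (vertex, label):
-- being compatible is a condition on each pair of entries and the arc from
-- the earlier to the later one.  In a substitution the condition on entries
-- from different operands only sees the operands x, y and the labels ℓ, ℓ′.
-- If the item (x , ℓ) also occurs earlier and later, an occurrence in between
-- can therefore be deleted or inserted without changing validity.  Hence an
-- operand may be replaced by the set of words that its orderings spell, each
-- reduced by such deletions to a word with at most two occurrences of every
-- label, so to length at most 2k.  The set of reduced words of a substitution
-- is found by trying all words of length at most 2kp over [p] × [k]; union and
-- join are substitutions with p = 2.  As the decomposition determines all
-- arcs, only k is read from the encoded instance.
--
-- The work at a node depends on k, p, the template and sets of short words
-- only.  It is programmed in a language of primitive recursive terms, for
-- which evaluation time is bounded by a computable function of the input
-- size.  The number of nodes is linear in the number of vertices, which gives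
-- a linear bound for fixed k + mw.
module Submission where

open import Defs
open import Data.Bool using (Bool; true; false; T; if_then_else_; _∧_)
open import Data.Bool.Properties using (T-≡)
open import Data.Empty using (⊥; ⊥-elim)
open import Data.Fin as Fin using (Fin; zero; suc; #_; toℕ; splitAt; _↑ʳ_)
open import Data.Fin.Patterns
open import Data.Fin.Permutation using (↔⇒≡; inverseʳ; _⟨$⟩ˡ_)
open import Data.Fin.Properties as FinP
  using (1↔⊤; +↔⊎; splitAt-join; toℕ-fromℕ; toℕ-fromℕ<; toℕ-inject₁; toℕ-injective; toℕ<n)
open import Data.Fin.Subset using (Nonempty)
open import Data.Fin.Subset.Properties using (nonempty?)
open import Data.List as List using (List; []; _∷_; _++_; allFin; length)
open import Data.List.Extrema.Nat using (xs≤max; ⊥≤max)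
import Data.List.Membership.DecPropositional as DecMembership
open import Data.List.Membership.Propositional using (_∈_; _∉_; find; lose)
open import Data.List.Membership.Propositional.Properties
  using (∈-allFin; ∈-concatMap⁺; ∈-concatMap⁻; ∈-lookup; ∈-map⁺; ∈-map⁻; ∈-tabulate⁺; ∈-++⁺ʳ; ∈-++⁺ˡ)
open import Data.List.Properties
  using (length-map; length-tabulate; map-injective; map-++; map-∘; ++-assoc; ++-identityʳ;
         ∷-injectiveʳ; ∷-injectiveˡ)
open import Data.List.Relation.Unary.All as All using (All; []; _∷_)
open import Data.List.Relation.Unary.All.Properties using (++⁻ʳ)
open import Data.List.Relation.Unary.AllPairs as AllPairs using (AllPairs; []; _∷_)
import Data.List.Relation.Unary.AllPairs.Properties as AllPairsP
open import Data.List.Relation.Unary.Any as Any using (Any; here; there)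
open import Data.List.Relation.Unary.Any.Properties using (lookup-index)
open import Data.Maybe using (Maybe; just; nothing)
open import Data.Nat using (ℕ; zero; suc; _+_; _*_; _^_; _<_; _≤_; z≤n; s≤s)
open import Data.Nat.Properties
open import Data.Nat.Tactic.RingSolver using (solve-∀)
open import Data.Product using (Σ; Σ-syntax; ∃-syntax; _×_; _,_; map₁; proj₁; proj₂)
open import Data.Sum as Sum using (_⊎_; inj₁; inj₂)
open import Data.Sum.Function.Propositional using (_⊎-↔_)
open import Data.These using (fromThat; fromThis)
open import Data.Unit using (⊤; tt)
open import Data.Vec as Vec using (Vec; []; _∷_)
import Data.Vec.Membership.Propositional.Properties as VecMembership
open import Data.Vec.Properties using (lookup∘tabulate; lookup⇒[]=)
open import Data.Vec.Relation.Unary.All as VecAll using ([]; _∷_)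
open import Function using (_∘_; _⇔_; _↔_; flip; id; mk⇔; mk↔ₛ′; Equivalence; Inverse)
open import Function.Properties.Inverse using (↔-sym; ↔-trans)
open import Relation.Binary.Construct.Closure.ReflexiveTransitive as Star using (Star; ε; _◅_; _◅◅_)
open import Relation.Binary.Core using (_Preserves_⟶_)
open import Relation.Binary.Definitions using (tri<; tri≈; tri>; DecidableEquality)
open import Relation.Binary.PropositionalEquality
open import Relation.Nullary using (¬_; Dec; yes; no; does)
open import Relation.Nullary.Decidable using (_×-dec_; _⊎-dec_)
open Equivalence using (to; from)
open LabeledDigraph

-- A label ℓ in the word of operand x is the item (x , ℓ) of the interleaved word. A deletion in one
-- projection therefore lifts to a deletion in the interleaving, forwards and backwards, and leaves
-- the other projections alone. One relation, `⟶*`, thus serves inside the operands, in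
-- interleavings and, once the operands are forgotten, in the resulting label word.
--
-- The cost of a node can be bounded uniformly because a summary is a filtered sublist of the words
-- of length at most 2k: its size depends on k alone, however deep the expression is.
--
-- Two demands of the statement shape the machinery. The function f must itself be computed by a
-- program, so every bound carries a term that computes it. And running time is a derivation in the
-- model, so terms are compiled and evaluated once and for all, with cost and value size bounded
-- together. Only the recursion over expressions, which does not follow the spine of a list, is
-- written directly as functions of the model.

-- Trees and primitive recursive terms

size : Tree → ℕ
size nil     = 0
size (x ∙ y) = suc (size x + size y)

caseTree : {X : Set} → Tree → X → (Tree → Tree → X) → X
caseTree nil     n c = n
caseTree (x ∙ y) n c = c x y

foldTree : Tree → (Tree → Tree → Tree → Tree) → Tree → Tree
foldTree z s nil     = z
foldTree z s (x ∙ y) = s (foldTree z s y) x y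

treeEq : Tree → Tree → Tree
treeEq nil     nil     = nil ∙ nil
treeEq nil     (_ ∙ _) = nil
treeEq (_ ∙ _) nil     = nil
treeEq (a ∙ b) (c ∙ d) = caseTree (treeEq a c) nil (λ _ _ → treeEq b d)

-- Recursion along the right spine, with a fixed environment.  In
-- fold z s e the base z sees nil and the step s sees the result for the
-- tail, the head, the tail and the whole list in front of the environment:
-- these are the variables that the compiled function has anyway.
data PR : ℕ → Set where
  var  : ∀ {j} → Fin j → PR j
  nil  : ∀ {j} → PR j
  _∙_  : ∀ {j} → PR j → PR j → PR j
  case : ∀ {j} → PR j → PR j → PR (2 + j) → PR j
  comp : ∀ {j a} → PR a → Vec (PR j) a → PR j
  fold : ∀ {j} → PR (1 + j) → PR (4 + j) → PR j → PR j
  eq   : ∀ {j} → PR j → PR j → PR j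

mutual
  value : ∀ {j} → PR j → Vec Tree j → Tree
  value (var x)      ρ = Vec.lookup ρ x
  value nil          ρ = nil
  value (a ∙ b)      ρ = value a ρ ∙ value b ρ
  value (case e a b) ρ = caseTree (value e ρ) (value a ρ) (λ x y → value b (x ∷ y ∷ ρ))
  value (comp f es)  ρ = value f (values es ρ)
  value (fold z s e) ρ =
    foldTree (value z (nil ∷ ρ)) (λ r x y → value s (r ∷ x ∷ y ∷ (x ∙ y) ∷ ρ)) (value e ρ)
  value (eq a b)     ρ = treeEq (value a ρ) (value b ρ)

  values : ∀ {j a} → Vec (PR j) a → Vec Tree j → Vec Tree a
  values []       ρ = []
  values (e ∷ es) ρ = value e ρ ∷ values es ρ

-- Representable bounds

iter : (ℕ → ℕ) → ℕ → ℕ → ℕ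
iter g zero    x = x
iter g (suc n) x = g (iter g n x)

literal : ∀ {j} → ℕ → PR j
literal zero    = nil
literal (suc n) = nil ∙ literal n

value-literal : ∀ {j} n (ρ : Vec Tree j) → value (literal n) ρ ≡ encodeℕ n
value-literal zero    ρ = refl
value-literal (suc n) ρ = cong (nil ∙_) (value-literal n ρ)

append : PR 2
append = fold (var 2F) (var 1F ∙ var 0F) (var 0F)

append-encodeℕ : ∀ m n → value append (encodeℕ m ∷ encodeℕ n ∷ []) ≡ encodeℕ (m + n)
append-encodeℕ zero    n = refl
append-encodeℕ (suc m) n = cong (nil ∙_) (append-encodeℕ m n)

-- `mono` allows a bound to be applied to any upper estimate of the input size; `term` is carried
-- along so that the final time bound can be compiled to a program.
record Bound : Set where
  field
    at         : ℕ → ℕ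
    mono       : at Preserves _≤_ ⟶ _≤_
    term       : PR 1
    represents : ∀ n → value term (encodeℕ n ∷ []) ≡ encodeℕ (at n)

open Bound

idB : Bound
idB = record { at = id ; mono = id ; term = var 0F ; represents = λ _ → refl }

constB : ℕ → Bound
constB c = record
  { at = λ _ → c ; mono = λ _ → ≤-refl
  ; term = literal c ; represents = λ n → value-literal c (encodeℕ n ∷ []) }

infixr 6 _+B_
infixr 7 _*B_
infixr 9 _∘B_

_+B_ : Bound → Bound → Bound
a +B b = record
  { at   = λ n → at a n + at b n
  ; mono = λ m≤n → +-mono-≤ (mono a m≤n) (mono b m≤n)
  ; term = comp append (term a ∷ term b ∷ [])
  ; represents = λ n → trans
      (cong₂ (λ x y → value append (x ∷ y ∷ [])) (represents a n) (represents b n))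
      (append-encodeℕ (at a n) (at b n))
  }

_∘B_ : Bound → Bound → Bound
a ∘B b = record
  { at   = at a ∘ at b
  ; mono = mono a ∘ mono b
  ; term = comp (term a) (term b ∷ [])
  ; represents = λ n → trans (cong (λ x → value (term a) (x ∷ [])) (represents b n))
                             (represents a (at b n))
  }

_*B_ : Bound → Bound → Bound
a *B b = record
  { at   = λ n → at a n * at b n
  ; mono = λ m≤n → *-mono-≤ (mono a m≤n) (mono b m≤n)
  ; term = fold nil (comp append (comp (term b) (var 4F ∷ []) ∷ var 0F ∷ [])) (term a)
  ; represents = λ n → trans
      (cong (foldTree nil (λ r x y → value append (value (term b) (encodeℕ n ∷ []) ∷ r ∷ [])))
            (represents a n))
      (sum n (at a n))
  }
  where
  sum : ∀ n m → foldTree nil (λ r x y → value append (value (term b) (encodeℕ n ∷ []) ∷ r ∷ []))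
                  (encodeℕ m) ≡ encodeℕ (m * at b n)
  sum n zero    = refl
  sum n (suc m) = trans
    (cong₂ (λ x y → value append (x ∷ y ∷ [])) (represents b n) (sum n m))
    (append-encodeℕ (at b n) (m * at b n))

iter-mono : (g : Bound) → ∀ n → iter (at g) n Preserves _≤_ ⟶ _≤_
iter-mono g zero    = id
iter-mono g (suc n) = mono g ∘ iter-mono g n

iter-monoˡ : ∀ g → (∀ x → x ≤ g x) → ∀ {m n} x → m ≤ n → iter g m x ≤ iter g n x
iter-monoˡ g inc {n = zero}  x z≤n       = ≤-refl
iter-monoˡ g inc {n = suc n} x z≤n       = ≤-trans (iter-monoˡ g inc x (z≤n {n})) (inc _)
iter-monoˡ g inc {suc m} {suc n} x (s≤s p) = step (m≤n⇒m<n∨m≡n p)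
  where
  step : m < n ⊎ m ≡ n → g (iter g m x) ≤ g (iter g n x)
  step (inj₁ q)    = ≤-trans (iter-monoˡ g inc x q) (inc _)
  step (inj₂ refl) = ≤-refl

-- n ↦ gᵇ⁽ⁿ⁾(a(n)) for an increasing g = id + h.
iterB : Bound → Bound → Bound → Bound
iterB h b a = record
  { at   = λ n → iter (at g) (at b n) (at a n)
  ; mono = λ {m} {n} m≤n → ≤-trans (iter-mono g (at b m) (mono a m≤n))
      (iter-monoˡ (at g) (λ x → m≤m+n x _) (at a n) (mono b m≤n))
  ; term = fold (comp (term a) (var 1F ∷ [])) (comp (term g) (var 0F ∷ [])) (term b)
  ; represents = λ n → trans (cong (foldTree (value (term a) (encodeℕ n ∷ [])) (λ r x y → value (term g) (r ∷ [])))
         (represents b n)) (power n (at b n))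
  }
  where
  g : Bound
  g = idB +B h
  power : ∀ n m → foldTree (value (term a) (encodeℕ n ∷ [])) (λ r x y → value (term g) (r ∷ []))
                    (encodeℕ m) ≡ encodeℕ (iter (at g) m (at a n))
  power n zero    = represents a n
  power n (suc m) = trans (cong (λ x → value (term g) (x ∷ [])) (power n m))
                          (represents g (iter (at g) m (at a n)))

-- Linear in the first argument alone: equality descends both trees together and stops where either
-- ends.
equalB : Bound → Bound
equalB a = constB 12 *B (constB 1 +B (a +B a))

mutual
  -- For environments of values of size at most n, one number bounds both the cost and the size of
  -- the value. Sizes must be tracked because values become the environment of terms evaluated
  -- later.
  bound : ∀ {j} → PR j → Bound
  bound (var x)      = idB +B constB 1
  bound nil          = constB 1
  bound (a ∙ b)      = constB 1 +B bound a +B bound b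
  -- The two new variables are parts of the value of `e`, of size at most `at (bound e) n`; adding n
  -- covers the old variables too.
  bound (case e a b) = (constB 1 +B bound e) +B bound a +B bound b ∘B (idB +B bound e)
  bound (comp f es)  = (constB 1 +B bounds es) +B bound f ∘B bounds es
  -- 1 + j and 5 + j account for passing j + 1 arguments to the function that
  -- fold is compiled to.
  bound (fold {j} z s e) =
    (constB (1 + j) +B bound e) +B
    iterB (bound s +B constB (5 + j)) (bound e) ((idB +B bound e) +B constB 2 +B bound z)
  bound (eq a b)     = (constB 1 +B bound a +B bound b) +B equalB (bound a)

  bounds : ∀ {j a} → Vec (PR j) a → Bound
  bounds []       = constB 0
  bounds (e ∷ es) = bound e +B bounds es

-- Compilation

mutual
  -- The places of a term that need a function symbol of their own: every `comp`, for its inner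
  -- term, and every `fold`, for its loop. Compilation is parametric in the assignment of symbols to
  -- these places, so subterms can be treated before the table of functions is fixed.
  Slot : ∀ {j} → PR j → Set
  Slot (var x)      = ⊥
  Slot nil          = ⊥
  Slot (a ∙ b)      = Slot a ⊎ Slot b
  Slot (case e a b) = Slot e ⊎ Slot a ⊎ Slot b
  Slot (comp f es)  = Maybe (Slot f ⊎ Slots es)
  Slot (fold z s e) = Maybe (Slot z ⊎ Slot s ⊎ Slot e)
  Slot (eq a b)     = Slot a ⊎ Slot b

  Slots : ∀ {j a} → Vec (PR j) a → Set
  Slots []       = ⊥
  Slots (e ∷ es) = Slot e ⊎ Slots es

mutual
  slotArity : ∀ {j} (t : PR j) → Slot t → ℕ
  slotArity (a ∙ b)      (inj₁ s)        = slotArity a s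
  slotArity (a ∙ b)      (inj₂ s)        = slotArity b s
  slotArity (case e a b) (inj₁ s)        = slotArity e s
  slotArity (case e a b) (inj₂ (inj₁ s)) = slotArity a s
  slotArity (case e a b) (inj₂ (inj₂ s)) = slotArity b s
  slotArity (comp {a = a} f es) nothing  = a
  slotArity (comp f es) (just (inj₁ s))  = slotArity f s
  slotArity (comp f es) (just (inj₂ s))  = slotsArity es s
  slotArity (fold {j} z s e) nothing     = suc j
  slotArity (fold z s e) (just (inj₁ i))        = slotArity z i
  slotArity (fold z s e) (just (inj₂ (inj₁ i))) = slotArity s i
  slotArity (fold z s e) (just (inj₂ (inj₂ i))) = slotArity e i
  slotArity (eq a b)     (inj₁ s)        = slotArity a s
  slotArity (eq a b)     (inj₂ s)        = slotArity b s

  slotsArity : ∀ {j a} (es : Vec (PR j) a) → Slots es → ℕ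
  slotsArity (e ∷ es) (inj₁ s) = slotArity e s
  slotsArity (e ∷ es) (inj₂ s) = slotsArity es s

-- The arity is attached by an equation because the arity of a slot found through its number is only
-- propositionally the right one.
Func : ∀ {m} → (Fin m → ℕ) → ℕ → Set
Func {m} arity a = Σ[ g ∈ Fin m ] arity g ≡ a

module Compile {m} (arity : Fin m → ℕ) (equal : Func arity 2) where

  invoke : ∀ {j a} → Func arity a → Vec (Term arity j) a → Term arity j
  invoke (g , refl) es = call g es

  equalBody : Term arity 2
  equalBody =
    case (var 0F)
      (case (var 1F) (nil ∙ nil) nil)
      (case (var 3F) nil
        (case (invoke equal (var 2F ∷ var 0F ∷ []))
          nil
          (invoke equal (var 5F ∷ var 3F ∷ []))))

  mutual
    compile : ∀ {j} (t : PR j) → ((s : Slot t) → Func arity (slotArity t s)) → Term arity j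
    compile (var x)      ι = var x
    compile nil          ι = nil
    compile (a ∙ b)      ι = compile a (ι ∘ inj₁) ∙ compile b (ι ∘ inj₂)
    compile (case e a b) ι =
      case (compile e (ι ∘ inj₁)) (compile a (ι ∘ inj₂ ∘ inj₁)) (compile b (ι ∘ inj₂ ∘ inj₂))
    compile (comp f es)  ι = invoke (ι nothing) (compiles es (ι ∘ just ∘ inj₂))
    compile (fold z s e) ι =
      invoke (ι nothing) (compile e (ι ∘ just ∘ inj₂ ∘ inj₂) ∷ Vec.tabulate var)
    compile (eq a b)     ι =
      invoke equal (compile a (ι ∘ inj₁) ∷ compile b (ι ∘ inj₂) ∷ [])

    compiles : ∀ {j a} (es : Vec (PR j) a) → ((s : Slots es) → Func arity (slotsArity es s)) →
               Vec (Term arity j) a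
    compiles []       ι = []
    compiles (e ∷ es) ι = compile e (ι ∘ inj₁) ∷ compiles es (ι ∘ inj₂)

  foldBody : ∀ {j} → Func arity (suc j) → Term arity (1 + j) → Term arity (4 + j) → Term arity (suc j)
  foldBody g z s =
    case (var 0F) z (bind (invoke g (var 1F ∷ Vec.tabulate (λ i → var (3 ↑ʳ i)))) s)

  mutual
    slotBody : ∀ {j} (t : PR j) (ι : (s : Slot t) → Func arity (slotArity t s)) →
               (s : Slot t) → Term arity (slotArity t s)
    slotBody (a ∙ b)      ι (inj₁ s)        = slotBody a (ι ∘ inj₁) s
    slotBody (a ∙ b)      ι (inj₂ s)        = slotBody b (ι ∘ inj₂) s
    slotBody (case e a b) ι (inj₁ s)        = slotBody e (ι ∘ inj₁) s
    slotBody (case e a b) ι (inj₂ (inj₁ s)) = slotBody a (ι ∘ inj₂ ∘ inj₁) s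
    slotBody (case e a b) ι (inj₂ (inj₂ s)) = slotBody b (ι ∘ inj₂ ∘ inj₂) s
    slotBody (comp f es)  ι nothing         = compile f (ι ∘ just ∘ inj₁)
    slotBody (comp f es)  ι (just (inj₁ s)) = slotBody f (ι ∘ just ∘ inj₁) s
    slotBody (comp f es)  ι (just (inj₂ s)) = slotsBody es (ι ∘ just ∘ inj₂) s
    slotBody (fold z s e) ι nothing =
      foldBody (ι nothing) (compile z (ι ∘ just ∘ inj₁)) (compile s (ι ∘ just ∘ inj₂ ∘ inj₁))
    slotBody (fold z s e) ι (just (inj₁ i))        = slotBody z (ι ∘ just ∘ inj₁) i
    slotBody (fold z s e) ι (just (inj₂ (inj₁ i))) = slotBody s (ι ∘ just ∘ inj₂ ∘ inj₁) i
    slotBody (fold z s e) ι (just (inj₂ (inj₂ i))) = slotBody e (ι ∘ just ∘ inj₂ ∘ inj₂) i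
    slotBody (eq a b)     ι (inj₁ s)        = slotBody a (ι ∘ inj₁) s
    slotBody (eq a b)     ι (inj₂ s)        = slotBody b (ι ∘ inj₂) s

    slotsBody : ∀ {j a} (es : Vec (PR j) a) (ι : (s : Slots es) → Func arity (slotsArity es s)) →
                (s : Slots es) → Term arity (slotsArity es s)
    slotsBody (e ∷ es) ι (inj₁ s) = slotBody e (ι ∘ inj₁) s
    slotsBody (e ∷ es) ι (inj₂ s) = slotsBody es (ι ∘ inj₂) s

-- Correctness and cost of compiled terms

module Evaluation (P : Program) (equal : Func (Program.arity P) 2) where
  open Program P
  open Semantics P public
  open Compile arity equal

  bodyOf : ∀ {a} → Func arity a → Term arity a
  bodyOf (g , refl) = body g

  invoke-⇓ : ∀ {j a} {ρ : Vec Tree j} (g : Func arity a) {es vs v c c′} →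
             ρ ⊢* es ⇓ vs cost c → vs ⊢ bodyOf g ⇓ v cost c′ →
             ρ ⊢ invoke g es ⇓ v cost suc (c + c′)
  invoke-⇓ (g , refl) = call

  _⊢_⇓_within_ : ∀ {j} → Vec Tree j → Term arity j → Tree → ℕ → Set
  ρ ⊢ e ⇓ v within b = ∃[ c ] (ρ ⊢ e ⇓ v cost c) × c ≤ b × size v ≤ b

  AtMost : ∀ {j} → ℕ → Vec Tree j → Set
  AtMost n = VecAll.All (λ v → size v ≤ n)

  weaken : ∀ {j m n} {ρ : Vec Tree j} → m ≤ n → AtMost m ρ → AtMost n ρ
  weaken m≤n = VecAll.map (λ p → ≤-trans p m≤n)

  -- Separates evaluation from assembly: all that is assumed of the program is that the slots of the
  -- term at hand have the expected bodies, and this is inherited by subterms.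
  Linked : ∀ {j} (t : PR j) → ((s : Slot t) → Func arity (slotArity t s)) → Set
  Linked t ι = ∀ s → bodyOf (ι s) ≡ slotBody t ι s

  Linkeds : ∀ {j a} (es : Vec (PR j) a) → ((s : Slots es) → Func arity (slotsArity es s)) → Set
  Linkeds es ι = ∀ s → bodyOf (ι s) ≡ slotsBody es ι s

  vars-⇓ : ∀ {i j} (σ : Vec Tree i) (ρ : Vec Tree j) (f : Fin i → Fin j) →
           (∀ x → Vec.lookup ρ (f x) ≡ Vec.lookup σ x) →
           ρ ⊢* Vec.tabulate (λ x → var (f x)) ⇓ σ cost i
  vars-⇓ []      ρ f h = []
  vars-⇓ (v ∷ σ) ρ f h =
    subst (λ w → ρ ⊢ var (f zero) ⇓ w cost 1) (h zero) (var (f zero)) ∷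
    vars-⇓ σ ρ (f ∘ suc) (h ∘ suc)

  size-treeEq : ∀ a b → size (treeEq a b) ≤ 1
  size-treeEq nil     nil     = ≤-refl
  size-treeEq nil     (_ ∙ _) = z≤n
  size-treeEq (_ ∙ _) nil     = z≤n
  size-treeEq (a ∙ b) (c ∙ d) with treeEq a c
  ... | nil   = z≤n
  ... | _ ∙ _ = size-treeEq b d

  -- The 8 counts three cases, their two scrutinised variables and the call comparing the first
  -- components with its two arguments; the 3 is the overhead of the second call. The factor 12
  -- absorbs both with one unit to spare.
  equal-step : ∀ s t {c c′} → c ≤ 12 * suc (s + s) → c′ ≤ 3 + 12 * suc (t + t) →
               8 + (c + c′) ≤ 12 * suc (suc (s + t) + suc (s + t))
  equal-step s t p q = ≤-trans (+-monoʳ-≤ 8 (+-mono-≤ p q)) (≤-trans (n≤1+n _) (≤-reflexive (arrange s t)))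
    where
    arrange : ∀ s t → 9 + (12 * suc (s + s) + (3 + 12 * suc (t + t))) ≡
                      12 * suc (suc (s + t) + suc (s + t))
    arrange = solve-∀

  module _ (equal-linked : bodyOf equal ≡ equalBody) where

    private
      enter : ∀ {vs v c} → vs ⊢ equalBody ⇓ v cost c → vs ⊢ bodyOf equal ⇓ v cost c
      enter = subst (λ b → _ ⊢ b ⇓ _ cost _) (sym equal-linked)

    equal-⇓ : ∀ a b → ∃[ c ] (a ∷ b ∷ [] ⊢ equalBody ⇓ treeEq a b cost c) ×
                             c ≤ 12 * suc (size a + size a)
    equal-⇓ nil nil = _ , case-nil (var _) (case-nil (var _) (nil ∙ nil)) , m≤m+n 7 5
    equal-⇓ nil (_ ∙ _) = _ , case-nil (var _) (case-cons (var _) nil) , m≤m+n 5 7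
    equal-⇓ (a ∙ b) nil =
      _ , case-cons (var _) (case-nil (var _) nil) ,
      ≤-trans (m≤m+n 5 7) (*-monoʳ-≤ 12 (s≤s (z≤n {size (a ∙ b) + size (a ∙ b)})))
    equal-⇓ (a ∙ b) (c ∙ d) with treeEq a c | equal-⇓ a c
    ... | nil | c₁ , d₁ , p =
      _ , case-cons (var _) (case-cons (var _)
            (case-nil (invoke-⇓ equal (var _ ∷ (var _ ∷ [])) (enter d₁)) nil)) ,
      equal-step (size a) (size b) p (s≤s z≤n)
    ... | u ∙ w | c₁ , d₁ , p with equal-⇓ b d
    ...   | c₂ , d₂ , q =
      _ , case-cons (var _) (case-cons (var _)
            (case-cons (invoke-⇓ equal (var _ ∷ (var _ ∷ [])) (enter d₁))
                       (invoke-⇓ equal (var _ ∷ (var _ ∷ [])) (enter d₂)))) ,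
      equal-step (size a) (size b) p (+-monoʳ-≤ 3 q)

    module _ {j} (g : Func arity (suc j)) {z : Term arity (1 + j)} {s : Term arity (4 + j)}
             (linked : bodyOf g ≡ foldBody g z s) (Bz Bs : Bound) {n m : ℕ}
             {ρ : Vec Tree j} (ps : AtMost n ρ) {v : Tree} {f : Vec Tree (4 + j) → Tree}
             (z-⇓ : (nil ∷ ρ) ⊢ z ⇓ v within at Bz n)
             (s-⇓ : ∀ {i} {σ : Vec Tree (4 + j)} → AtMost i σ → σ ⊢ s ⇓ f σ within at Bs i)
             where

      private
        G : ℕ → ℕ
        G w = w + (at Bs w + (5 + j))

        X : ℕ
        -- Starting above n and m makes every iterate bound the sizes of the environment and of the
        -- list as well; the 2 pays for the last `case` and its variable.
        X = (n + m) + (2 + at Bz n)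

        grows : ∀ w → w ≤ G w
        grows w = m≤m+n w _

        spineLength : Tree → ℕ
        spineLength nil     = 0
        spineLength (x ∙ y) = suc (spineLength y)

        spineLength≤size : ∀ t → spineLength t ≤ size t
        spineLength≤size nil     = z≤n
        spineLength≤size (x ∙ y) = s≤s (≤-trans (spineLength≤size y) (m≤n+m _ _))

        X≤iter : ∀ i → X ≤ iter G i X
        X≤iter i = iter-monoˡ G grows X (z≤n {i})

        result : Tree → Tree
        result = foldTree v (λ r x y → f (r ∷ x ∷ y ∷ (x ∙ y) ∷ ρ))

        -- The result for the tail is no larger than the iterate reached so far, so that iterate
        -- bounds the whole environment of the step, and one application of `G` pays for one more
        -- round.
        loop : ∀ t → size t ≤ m → (t ∷ ρ) ⊢ foldBody g z s ⇓ result t within iter G (spineLength t) X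
        loop nil _ = let c , d , p , q = z-⇓ in
          _ , case-nil (var _) d , ≤-trans (s≤s (s≤s p)) (m≤n+m _ (n + m)) ,
          ≤-trans q (≤-trans (m≤n+m _ 2) (m≤n+m _ (n + m)))
        loop (x ∙ y) t≤m = conclude (loop y (≤-trans (m≤n+m _ _) xy≤m))
          where
          W = iter G (spineLength y) X

          xy≤m : size x + size y ≤ m
          xy≤m = ≤-trans (n≤1+n _) t≤m

          m≤W : m ≤ W
          m≤W = ≤-trans (≤-trans (m≤n+m m n) (m≤m+n _ _)) (X≤iter (spineLength y))

          n≤W : n ≤ W
          n≤W = ≤-trans (≤-trans (m≤m+n n m) (m≤m+n _ _)) (X≤iter (spineLength y))

          arrange : ∀ c j c′ → suc (1 + suc (suc ((1 + j) + c) + c′)) ≡ c + (c′ + (5 + j))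
          arrange = solve-∀

          conclude : (y ∷ ρ) ⊢ foldBody g z s ⇓ result y within W →
                     ((x ∙ y) ∷ ρ) ⊢ foldBody g z s ⇓ result (x ∙ y) within G W
          conclude (c , d , p , q)
            with s-⇓ (q ∷ ≤-trans (≤-trans (m≤m+n _ _) xy≤m) m≤W ∷
                      ≤-trans (≤-trans (m≤n+m _ _) xy≤m) m≤W ∷ ≤-trans t≤m m≤W ∷ weaken n≤W ps)
          ... | c′ , d′ , p′ , q′ =
            _ , case-cons (var _)
                  (bind (invoke-⇓ g (var _ ∷ vars-⇓ ρ _ (3 ↑ʳ_) (λ _ → refl))
                                  (subst (λ b → _ ⊢ b ⇓ _ cost _) (sym linked) d)) d′) ,
            ≤-trans (≤-reflexive (arrange c j c′)) (+-mono-≤ p (+-monoˡ-≤ (5 + j) p′)) ,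
            ≤-trans q′ (≤-trans (m≤m+n _ (5 + j)) (m≤n+m _ W))

      fold-⇓ : ∀ t → size t ≤ m → (t ∷ ρ) ⊢ foldBody g z s ⇓ result t within iter G m X
      fold-⇓ t t≤m with c , d , p , q ← loop t t≤m =
        c , d , ≤-trans p more , ≤-trans q more
        where more = iter-monoˡ G grows X (≤-trans (spineLength≤size t) t≤m)

    mutual
      evaluate : ∀ {j} (t : PR j) ι → Linked t ι → ∀ {n} {ρ : Vec Tree j} → AtMost n ρ →
                 ρ ⊢ compile t ι ⇓ value t ρ within at (bound t) n
      evaluate (var x) ι l {n} {ρ} ps =
        1 , var x , m≤n+m 1 n , ≤-trans (VecAll.lookup ps (VecMembership.∈-lookup x ρ)) (m≤m+n n 1)
      evaluate nil ι l ps = 1 , nil , ≤-refl , z≤n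
      evaluate (a ∙ b) ι l ps
        with evaluate a (ι ∘ inj₁) (l ∘ inj₁) ps | evaluate b (ι ∘ inj₂) (l ∘ inj₂) ps
      ... | c , d , p , q | c′ , d′ , p′ , q′ =
        _ , (d ∙ d′) , s≤s (+-mono-≤ p p′) , s≤s (+-mono-≤ q q′)
      evaluate (case e a b) ι l {n} {ρ} ps
        with value e ρ | evaluate e (ι ∘ inj₁) (l ∘ inj₁) ps
      ... | nil | c , d , p , q
        with evaluate a (ι ∘ inj₂ ∘ inj₁) (l ∘ inj₂ ∘ inj₁) ps
      ...   | c′ , d′ , p′ , q′ =
        _ , case-nil d d′ , s≤s (+-mono-≤ p (m≤n⇒m≤n+o _ p′)) ,
        m≤n⇒m≤o+n (suc (at (bound e) n)) (m≤n⇒m≤n+o _ q′)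
      evaluate (case e a b) ι l {n} {ρ} ps | x ∙ y | c , d , p , q
        with evaluate b (ι ∘ inj₂ ∘ inj₂) (l ∘ inj₂ ∘ inj₂)
               (≤-trans (≤-trans (m≤m+n (size x) (size y)) (≤-trans (n≤1+n _) q)) (m≤n+m _ n) ∷
                ≤-trans (≤-trans (m≤n+m (size y) (size x)) (≤-trans (n≤1+n _) q)) (m≤n+m _ n) ∷
                weaken (m≤m+n n _) ps)
      ...   | c′ , d′ , p′ , q′ =
        _ , case-cons d d′ , s≤s (+-mono-≤ p (m≤n⇒m≤o+n _ p′)) ,
        m≤n⇒m≤o+n (suc (at (bound e) n)) (m≤n⇒m≤o+n _ q′)
      evaluate (comp f es) ι l {n} ps
        with evaluates es (ι ∘ just ∘ inj₂) (l ∘ just ∘ inj₂) ps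
      ... | c , d , p , q with evaluate f (ι ∘ just ∘ inj₁) (l ∘ just ∘ inj₁) q
      ...   | c′ , d′ , p′ , q′ =
        _ , invoke-⇓ (ι nothing) d (subst (λ b → _ ⊢ b ⇓ _ cost _) (sym (l nothing)) d′) ,
        s≤s (+-mono-≤ p p′) , m≤n⇒m≤o+n (suc (at (bounds es) n)) q′
      evaluate (fold {j} z s e) ι l {n} {ρ} ps
        with value e ρ | evaluate e (ι ∘ just ∘ inj₂ ∘ inj₂) (l ∘ just ∘ inj₂ ∘ inj₂) ps
      ... | t | c , d , p , q
        with fold-⇓ (ι nothing) (l nothing) (bound z) (bound s) {m = at (bound e) n} ps
               (evaluate z (ι ∘ just ∘ inj₁) (l ∘ just ∘ inj₁) (z≤n ∷ ps))
               (evaluate s (ι ∘ just ∘ inj₂ ∘ inj₁) (l ∘ just ∘ inj₂ ∘ inj₁)) t q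
      ...   | c′ , d′ , p′ , q′ =
        _ , invoke-⇓ (ι nothing) (d ∷ vars-⇓ ρ ρ id (λ _ → refl))
              (subst (λ b → _ ⊢ b ⇓ _ cost _) (sym (l nothing)) d′) ,
        ≤-trans (≤-reflexive (cong (λ x → suc (x + c′)) (+-comm c j)))
          (+-mono-≤ (s≤s (+-monoʳ-≤ j p)) p′) ,
        m≤n⇒m≤o+n (suc j + at (bound e) n) q′
      evaluate (eq a b) ι l {n} {ρ} ps
        with evaluate a (ι ∘ inj₁) (l ∘ inj₁) ps | evaluate b (ι ∘ inj₂) (l ∘ inj₂) ps
           | equal-⇓ (value a ρ) (value b ρ)
      ... | c , d , p , q | c′ , d′ , p′ , q′ | c″ , d″ , p″ =
        _ , invoke-⇓ equal (d ∷ (d′ ∷ [])) (enter d″) ,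
        s≤s (+-mono-≤ (+-mono-≤ p (≤-trans (≤-reflexive (+-identityʳ c′)) p′))
          (≤-trans p″ (*-monoʳ-≤ 12 (s≤s (+-mono-≤ q q))))) ,
        ≤-trans (size-treeEq (value a ρ) (value b ρ)) (s≤s z≤n)

      evaluates : ∀ {j a} (es : Vec (PR j) a) ι → Linkeds es ι → ∀ {n} {ρ : Vec Tree j} →
                  AtMost n ρ → ∃[ c ] (ρ ⊢* compiles es ι ⇓ values es ρ cost c) ×
                  c ≤ at (bounds es) n × AtMost (at (bounds es) n) (values es ρ)
      evaluates []       ι l ps = 0 , [] , z≤n , []
      evaluates (e ∷ es) ι l ps
        with evaluate e (ι ∘ inj₁) (l ∘ inj₁) ps | evaluates es (ι ∘ inj₂) (l ∘ inj₂) ps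
      ... | c , d , p , q | c′ , d′ , p′ , q′ =
        _ , d ∷ d′ , +-mono-≤ p p′ , ≤-trans q (m≤m+n _ _) ∷ weaken (m≤n+m _ _) q′

-- Numbering the compiled functions

-- Converts the tree-shaped type of slots into the `Fin count` that a program demands for its
-- function symbols; `element-index` recovers a slot from its number.
record Enumeration (S : Set) : Set where
  field
    count    : ℕ
    element       : Fin count → S
    index    : S → Fin count
    element-index : ∀ s → element (index s) ≡ s

enumerate-⊥ : Enumeration ⊥
enumerate-⊥ = record { count = 0 ; element = λ () ; index = λ () ; element-index = λ () }

enumerate-⊎ : ∀ {S T} → Enumeration S → Enumeration T → Enumeration (S ⊎ T)
enumerate-⊎ E F = record
  { count    = E.count + F.count
  ; element  = Sum.map E.element F.element ∘ splitAt E.count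
  ; index    = Fin.join E.count F.count ∘ Sum.map E.index F.index
  ; element-index = λ s → trans (cong (Sum.map E.element F.element) (splitAt-join E.count F.count (Sum.map E.index F.index s)))
                           (inverse s)
  }
  where
  module E = Enumeration E
  module F = Enumeration F
  inverse : ∀ s → Sum.map E.element F.element (Sum.map E.index F.index s) ≡ s
  inverse (inj₁ s) = cong inj₁ (E.element-index s)
  inverse (inj₂ s) = cong inj₂ (F.element-index s)

enumerate-Maybe : ∀ {S} → Enumeration S → Enumeration (Maybe S)
enumerate-Maybe E = record
  { count    = suc E.count
  ; element  = λ { zero → nothing ; (suc i) → just (E.element i) }
  ; index    = λ { nothing → zero ; (just s) → suc (E.index s) }
  ; element-index = λ { nothing → refl ; (just s) → cong just (E.element-index s) }
  }
  where module E = Enumeration E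

mutual
  slots : ∀ {j} (t : PR j) → Enumeration (Slot t)
  slots (var x)      = enumerate-⊥
  slots nil          = enumerate-⊥
  slots (a ∙ b)      = enumerate-⊎ (slots a) (slots b)
  slots (case e a b) = enumerate-⊎ (slots e) (enumerate-⊎ (slots a) (slots b))
  slots (comp f es)  = enumerate-Maybe (enumerate-⊎ (slots f) (slotss es))
  slots (fold z s e) = enumerate-Maybe (enumerate-⊎ (slots z) (enumerate-⊎ (slots s) (slots e)))
  slots (eq a b)     = enumerate-⊎ (slots a) (slots b)

  slotss : ∀ {j a} (es : Vec (PR j) a) → Enumeration (Slots es)
  slotss []       = enumerate-⊥
  slotss (e ∷ es) = enumerate-⊎ (slots e) (slotss es)

-- Function 0 is tree equality; functions 1 and 2 are free for recursions
-- that are not primitive.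
module Assembly {j} (t : PR j) where
  open Enumeration (slots t)

  arity : Fin (3 + count) → ℕ
  arity 0F                  = 2
  arity 1F                  = 2
  arity 2F                  = 2
  arity (suc (suc (suc i))) = slotArity t (element i)

  equal : Func arity 2
  equal = 0F , refl

  slot : (s : Slot t) → Func arity (slotArity t s)
  slot s = 3 ↑ʳ index s , cong (slotArity t) (element-index s)

  open Compile arity equal public

  program : Term arity 2 → Term arity 2 → Term arity 1 → Program
  program f g main = record { arity = arity ; body = body ; main = main }
    where
    body : ∀ i → Term arity (arity i)
    body 0F                  = equalBody
    body 1F                  = f
    body 2F                  = g
    body (suc (suc (suc i))) = slotBody t slot (element i)

  module Linking (f g : Term arity 2) (main : Term arity 1) where
    open Evaluation (program f g main) equal public

    linked : Linked t slot
    linked s = at-slot (index s) (element-index s)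
      where
      -- Generalised over the slot, so that the equation, and with it the arity cast, can be matched
      -- with `refl`.
      at-slot : ∀ i {s} (e : element i ≡ s) →
                bodyOf (3 ↑ʳ i , cong (slotArity t) e) ≡ slotBody t slot s
      at-slot i refl = refl

computable : (B : Bound) → Computable (at B)
computable B = program nil nil main , run
  where
  open Assembly (term B)
  main : Term arity 1
  main = compile (term B) slot
  open Linking nil nil main
  run : ∀ m → ∃[ t ] Run (program nil nil main) (encodeℕ m) (encodeℕ (at B m)) t
  run m with evaluate refl (term B) slot linked {ρ = encodeℕ m ∷ []} (≤-refl ∷ [])
  ... | t , d , _ = t , subst (λ v → _ ⊢ main ⇓ v cost t) (represents B m) d

-- A statement about values alone, read off from evaluation: any program that contains the compiled
-- term yields the size bound.
size-value : ∀ {j} (t : PR j) {n} {ρ : Vec Tree j} → VecAll.All (λ v → size v ≤ n) ρ →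
             size (value t ρ) ≤ at (bound t) n
size-value t ps = let _ , _ , _ , p = evaluate refl t slot linked ps in p
  where
  open Assembly t
  open Linking nil nil nil

-- List processing by primitive recursive terms

spine : Tree → List Tree
spine nil     = []
spine (x ∙ y) = x ∷ spine y

IsTrue : Tree → Set
IsTrue nil     = ⊥
IsTrue (_ ∙ _) = ⊤

true-treeEq : ∀ a b → IsTrue (treeEq a b) ⇔ a ≡ b
true-treeEq a b = mk⇔ (sound a b) (λ { refl → complete a })
  where
  sound : ∀ a b → IsTrue (treeEq a b) → a ≡ b
  sound nil     nil     _ = refl
  sound (a ∙ b) (c ∙ d) h with treeEq a c in e
  ... | _ ∙ _ = cong₂ _∙_ (sound a c (subst IsTrue (sym e) tt)) (sound b d h)
  complete : ∀ a → IsTrue (treeEq a a)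
  complete nil = tt
  complete (a ∙ b) with treeEq a a | complete a
  ... | _ ∙ _ | _ = complete b

shifted : ∀ {j} i → Vec (PR (i + j)) j
shifted i = Vec.tabulate (λ x → var (i ↑ʳ x))

values-vars : ∀ {i j} (σ : Vec Tree i) (ρ : Vec Tree j) (f : Fin i → Fin j) →
              (∀ x → Vec.lookup ρ (f x) ≡ Vec.lookup σ x) →
              values (Vec.tabulate (λ x → var (f x))) ρ ≡ σ
values-vars []      ρ f h = refl
values-vars (v ∷ σ) ρ f h = cong₂ _∷_ (h zero) (values-vars σ ρ (f ∘ suc) (h ∘ suc))

andPR : ∀ {j} → PR j → PR j → PR j
andPR a b = comp (case (var 0F) nil (var 3F)) (a ∷ b ∷ [])

true-andPR : ∀ {j} (a b : PR j) ρ →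
             IsTrue (value (andPR a b) ρ) ⇔ (IsTrue (value a ρ) × IsTrue (value b ρ))
true-andPR a b ρ with value a ρ
... | nil   = mk⇔ (λ ()) (λ ())
... | _ ∙ _ = mk⇔ (tt ,_) proj₂

spine-append : ∀ a b → spine (value append (a ∷ b ∷ [])) ≡ spine a ++ spine b
spine-append nil     b = refl
spine-append (x ∙ a) b = cong (x ∷_) (spine-append a b)

module _ {j} (f : PR (suc j)) where

  private
    onHead : PR (4 + j)
    onHead = comp f (var 1F ∷ shifted 4)

    value-onHead : ∀ {ρ} r x y w → value onHead (r ∷ x ∷ y ∷ w ∷ ρ) ≡ value f (x ∷ ρ)
    value-onHead {ρ} r x y w = cong (λ σ → value f (x ∷ σ)) (values-vars ρ _ (4 ↑ʳ_) (λ _ → refl))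

  mapPR filterPR concatMapPR anyPR allPR : PR j → PR j
  mapPR       = fold nil (onHead ∙ var 0F)
  filterPR    = fold nil (case onHead (var 0F) (var 3F ∙ var 2F))
  concatMapPR = fold nil (comp append (onHead ∷ var 0F ∷ []))
  anyPR       = fold nil (case onHead (var 0F) (nil ∙ nil))
  allPR       = fold (nil ∙ nil) (case onHead nil (var 2F))

  module _ (xs : PR j) (ρ : Vec Tree j) where

    private
      foldWith : Tree → PR (4 + j) → Tree → Tree
      foldWith z s = foldTree z (λ r x y → value s (r ∷ x ∷ y ∷ (x ∙ y) ∷ ρ))

    spine-mapPR : spine (value (mapPR xs) ρ) ≡ List.map (λ x → value f (x ∷ ρ)) (spine (value xs ρ))
    spine-mapPR = go (value xs ρ)
      where
      go : ∀ t → spine (foldWith nil (onHead ∙ var 0F) t) ≡ List.map (λ x → value f (x ∷ ρ)) (spine t)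
      go nil     = refl
      go (x ∙ y) = cong₂ _∷_ (value-onHead _ x y (x ∙ y)) (go y)

    spine-concatMapPR : spine (value (concatMapPR xs) ρ) ≡
                        List.concatMap (λ x → spine (value f (x ∷ ρ))) (spine (value xs ρ))
    spine-concatMapPR = go (value xs ρ)
      where
      go : ∀ t → spine (foldWith nil (comp append (onHead ∷ var 0F ∷ [])) t) ≡
                 List.concatMap (λ x → spine (value f (x ∷ ρ))) (spine t)
      go nil     = refl
      go (x ∙ y) = trans (spine-append (value onHead (_ ∷ x ∷ y ∷ (x ∙ y) ∷ ρ)) _)
        (cong₂ _++_ (cong spine (value-onHead _ x y (x ∙ y))) (go y))

    ∈-mapPR : ∀ {v} → v ∈ spine (value (mapPR xs) ρ) ⇔
              (∃[ x ] x ∈ spine (value xs ρ) × v ≡ value f (x ∷ ρ))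
    ∈-mapPR = mk⇔ (λ m → ∈-map⁻ _ (subst (_ ∈_) spine-mapPR m))
      λ { (x , x∈ , refl) → subst (_ ∈_) (sym spine-mapPR) (∈-map⁺ (λ x → value f (x ∷ ρ)) x∈) }

    ∈-concatMapPR : ∀ {v} → v ∈ spine (value (concatMapPR xs) ρ) ⇔
                    (∃[ x ] x ∈ spine (value xs ρ) × v ∈ spine (value f (x ∷ ρ)))
    ∈-concatMapPR = mk⇔ (λ m → find (∈-concatMap⁻ _ (subst (_ ∈_) spine-concatMapPR m)))
      λ { (x , x∈ , v∈) → subst (_ ∈_) (sym spine-concatMapPR)
            (∈-concatMap⁺ (λ x → spine (value f (x ∷ ρ))) (lose x∈ v∈)) }

    true-anyPR : IsTrue (value (anyPR xs) ρ) ⇔ Any (λ x → IsTrue (value f (x ∷ ρ))) (spine (value xs ρ))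
    true-anyPR = go (value xs ρ)
      where
      go : ∀ t → IsTrue (foldWith nil (case onHead (var 0F) (nil ∙ nil)) t) ⇔
                 Any (λ x → IsTrue (value f (x ∷ ρ))) (spine t)
      go nil     = mk⇔ (λ ()) (λ ())
      go (x ∙ y)
        with r ← foldWith nil (case onHead (var 0F) (nil ∙ nil)) y | IH ← go y
        with value onHead (r ∷ x ∷ y ∷ (x ∙ y) ∷ ρ) | value-onHead {ρ} r x y (x ∙ y)
      ... | nil   | e = mk⇔ (there ∘ to IH)
                            λ { (here h) → ⊥-elim (subst IsTrue (sym e) h) ; (there h) → from IH h }
      ... | _ ∙ _ | e = mk⇔ (λ _ → here (subst IsTrue e tt)) (λ _ → tt)

    true-allPR : IsTrue (value (allPR xs) ρ) ⇔ All (λ x → IsTrue (value f (x ∷ ρ))) (spine (value xs ρ))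
    true-allPR = go (value xs ρ)
      where
      go : ∀ t → IsTrue (foldWith (nil ∙ nil) (case onHead nil (var 2F)) t) ⇔
                 All (λ x → IsTrue (value f (x ∷ ρ))) (spine t)
      go nil     = mk⇔ (λ _ → []) (λ _ → tt)
      go (x ∙ y)
        with r ← foldWith (nil ∙ nil) (case onHead nil (var 2F)) y | IH ← go y
        with value onHead (r ∷ x ∷ y ∷ (x ∙ y) ∷ ρ) | value-onHead {ρ} r x y (x ∙ y)
      ... | nil   | e = mk⇔ (λ ()) λ { (h ∷ _) → subst IsTrue (sym e) h }
      ... | _ ∙ _ | e = mk⇔ (λ h → subst IsTrue e tt ∷ to IH h) λ { (_ ∷ h) → from IH h }

    ∈-filterPR : ∀ {v} → v ∈ spine (value (filterPR xs) ρ) ⇔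
                 (v ∈ spine (value xs ρ) × IsTrue (value f (v ∷ ρ)))
    ∈-filterPR {v} = go (value xs ρ)
      where
      go : ∀ t → v ∈ spine (foldWith nil (case onHead (var 0F) (var 3F ∙ var 2F)) t) ⇔
                 (v ∈ spine t × IsTrue (value f (v ∷ ρ)))
      go nil     = mk⇔ (λ ()) (λ ())
      go (x ∙ y)
        with r ← foldWith nil (case onHead (var 0F) (var 3F ∙ var 2F)) y | IH ← go y
        with value onHead (r ∷ x ∷ y ∷ (x ∙ y) ∷ ρ) | value-onHead {ρ} r x y (x ∙ y)
      ... | nil   | e = mk⇔ (map₁ there ∘ to IH)
        λ { (here refl , h) → ⊥-elim (subst IsTrue (sym e) h) ; (there m , h) → from IH (m , h) }
      ... | _ ∙ _ | e = mk⇔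
        (λ { (here refl) → here refl , subst IsTrue e tt ; (there m) → map₁ there (to IH m) })
        (λ { (here refl , h) → here refl ; (there m , h) → there (from IH (m , h)) })

    size-filterPR : size (value (filterPR xs) ρ) ≤ size (value xs ρ)
    size-filterPR = go (value xs ρ)
      where
      go : ∀ t → size (foldWith nil (case onHead (var 0F) (var 3F ∙ var 2F)) t) ≤ size t
      go nil     = z≤n
      go (x ∙ y)
        with r ← foldWith nil (case onHead (var 0F) (var 3F ∙ var 2F)) y | IH ← go y
        with value onHead (r ∷ x ∷ y ∷ (x ∙ y) ∷ ρ)
      ... | nil   = ≤-trans IH (≤-trans (m≤n+m _ (size x)) (n≤1+n _))
      ... | _ ∙ _ = s≤s (+-monoʳ-≤ (size x) IH)

pairwisePR : ∀ {j} → PR (2 + j) → PR j → PR j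
pairwisePR f = fold (nil ∙ nil) (andPR (allPR (comp f (var 2F ∷ var 0F ∷ shifted 5)) (var 2F)) (var 0F))

true-pairwisePR : ∀ {j} (f : PR (2 + j)) (xs : PR j) ρ →
                  IsTrue (value (pairwisePR f xs) ρ) ⇔
                  AllPairs (λ x y → IsTrue (value f (x ∷ y ∷ ρ))) (spine (value xs ρ))
true-pairwisePR {j} f xs ρ = go (value xs ρ)
  where
  onPair : PR (5 + j)
  onPair = comp f (var 2F ∷ var 0F ∷ shifted 5)
  value-onPair : ∀ {x′ r x y w} → value onPair (x′ ∷ r ∷ x ∷ y ∷ w ∷ ρ) ≡ value f (x ∷ x′ ∷ ρ)
  value-onPair {x′} {r} {x} =
    cong (λ σ → value f (x ∷ x′ ∷ σ)) (values-vars ρ _ (5 ↑ʳ_) (λ _ → refl))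
  step : PR (4 + j)
  step = andPR (allPR onPair (var 2F)) (var 0F)
  go : ∀ t → IsTrue (foldTree (nil ∙ nil) (λ r x y → value step (r ∷ x ∷ y ∷ (x ∙ y) ∷ ρ)) t) ⇔
             AllPairs (λ x y → IsTrue (value f (x ∷ y ∷ ρ))) (spine t)
  go nil     = mk⇔ (λ _ → []) (λ _ → tt)
  go (x ∙ y) = mk⇔
    (λ h → let p , q = to both h in
      All.map (subst IsTrue value-onPair) (to every p) ∷ to (go y) q)
    (λ { (p ∷ q) → from both (from every (All.map (subst IsTrue (sym value-onPair)) p) , from (go y) q) })
    where
    both = true-andPR (allPR onPair (var 2F)) (var 0F) (_ ∷ x ∷ y ∷ (x ∙ y) ∷ ρ)
    every = true-allPR onPair (var 2F) (_ ∷ x ∷ y ∷ (x ∙ y) ∷ ρ)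

-- Encodings of words

spine-encodeList : ∀ xs → spine (encodeList xs) ≡ xs
spine-encodeList []       = refl
spine-encodeList (x ∷ xs) = cong (x ∷_) (spine-encodeList xs)

encodeList-injective : ∀ {xs ys} → encodeList xs ≡ encodeList ys → xs ≡ ys
encodeList-injective {xs} {ys} e =
  trans (sym (spine-encodeList xs)) (trans (cong spine e) (spine-encodeList ys))

encodeℕ-injective : ∀ {m n} → encodeℕ m ≡ encodeℕ n → m ≡ n
encodeℕ-injective {zero}  {zero}  e = refl
encodeℕ-injective {suc m} {suc n} e = cong suc (encodeℕ-injective (cong spine₂ e))
  where
  spine₂ : Tree → Tree
  spine₂ nil     = nil
  spine₂ (x ∙ y) = y

encodeFin : ∀ {k} → Fin k → Tree
encodeFin = encodeℕ ∘ toℕ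

encodeFin-injective : ∀ {k} {a b : Fin k} → encodeFin a ≡ encodeFin b → a ≡ b
encodeFin-injective = toℕ-injective ∘ encodeℕ-injective

encodeItem : ∀ {p k} → Fin p × Fin k → Tree
encodeItem (x , ℓ) = encodeFin x ∙ encodeFin ℓ

encodeWord : {X : Set} → (X → Tree) → List X → Tree
encodeWord enc = encodeList ∘ List.map enc

encodeWord-injective : ∀ {X : Set} {enc : X → Tree} → (∀ {a b} → enc a ≡ enc b → a ≡ b) →
                       ∀ {v w} → encodeWord enc v ≡ encodeWord enc w → v ≡ w
encodeWord-injective inj = map-injective inj ∘ encodeList-injective

Lists : {X : Set} → (X → Tree) → Tree → Set
Lists enc t = ∀ v → v ∈ spine t ⇔ (∃[ x ] v ≡ enc x)

rangePR : PR 1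
-- The tail of the numeral for k + 1 is the numeral for k, so the numbers below the argument appear
-- in decreasing order.
rangePR = fold nil (var 2F ∙ var 0F) (var 0F)

lists-range : ∀ k → Lists (encodeFin {k}) (value rangePR (encodeℕ k ∷ []))
lists-range zero    v = mk⇔ (λ ()) (λ ())
lists-range (suc k) v = mk⇔
  (λ { (here e) → Fin.fromℕ k , trans e (cong encodeℕ (sym (toℕ-fromℕ k)))
     ; (there m) → let i , e = to (lists-range k v) m in
         Fin.inject₁ i , trans e (cong encodeℕ (sym (toℕ-inject₁ i))) })
  λ { (i , refl) → member i }
  where
  open import Data.Fin.Properties using (toℕ-fromℕ; toℕ-inject₁; toℕ-fromℕ<; toℕ<n)
  member : ∀ i → encodeFin i ∈ spine (value rangePR (encodeℕ (suc k) ∷ []))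
  member i with m≤n⇒m<n∨m≡n (≤-pred (toℕ<n i))
  ... | inj₁ i<k = there (from (lists-range k _) (Fin.fromℕ< i<k , cong encodeℕ (sym (toℕ-fromℕ< i<k))))
  ... | inj₂ i≡k = here (cong encodeℕ i≡k)

alphabetPR : PR 2
alphabetPR = concatMapPR (mapPR (var 1F ∙ var 0F) (comp rangePR (var 2F ∷ []))) (comp rangePR (var 0F ∷ []))

lists-alphabet : ∀ p k → Lists (encodeItem {p} {k}) (value alphabetPR (encodeℕ p ∷ encodeℕ k ∷ []))
lists-alphabet p k v = mk⇔ sound complete
  where
  ρ : Vec Tree 2
  ρ = encodeℕ p ∷ encodeℕ k ∷ []
  item : PR 4
  item = var 1F ∙ var 0F
  range : PR 3
  range = comp rangePR (var 2F ∷ [])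
  row : ∀ {a w} → w ∈ spine (value (mapPR item range) (a ∷ ρ)) ⇔ _
  row {a} = ∈-mapPR item range (a ∷ ρ)
  rows : ∀ {w} → w ∈ spine (value alphabetPR ρ) ⇔ _
  rows = ∈-concatMapPR (mapPR item range) (comp rangePR (var 0F ∷ [])) ρ
  sound : v ∈ spine (value alphabetPR ρ) → ∃[ i ] v ≡ encodeItem i
  sound m
    with a , a∈ , v∈ ← to rows m
    with b , b∈ , refl ← to row v∈
    with x , refl ← to (lists-range p a) a∈
    with ℓ , refl ← to (lists-range k b) b∈
    = (x , ℓ) , refl
  complete : ∃[ i ] v ≡ encodeItem i → v ∈ spine (value alphabetPR ρ)
  complete ((x , ℓ) , e) =
    from rows (_ , from (lists-range p _) (x , refl) ,
               from row (_ , from (lists-range k _) (ℓ , refl) , e))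

-- `nil ∙ nil` is the list whose only member is the empty word. Every round prefixes each letter to
-- each word found so far and restores the empty word, so all lengths up to the second argument
-- occur.
wordsPR : PR 2
wordsPR = fold (nil ∙ nil) (nil ∙ concatMapPR (mapPR (var 1F ∙ var 0F) (var 1F)) (var 4F)) (var 1F)

∈-words : ∀ {X : Set} {enc : X → Tree} {A} → Lists enc A → ∀ n v →
          v ∈ spine (value wordsPR (A ∷ encodeℕ n ∷ [])) ⇔
          (∃[ w ] length w ≤ n × v ≡ encodeWord enc w)
∈-words {X} {enc} {A} lists zero v = mk⇔
  (λ { (here refl) → [] , z≤n , refl })
  λ { ([] , _ , e) → here e }
∈-words {X} {enc} {A} lists (suc n) v = mk⇔
  (λ { (here refl) → [] , z≤n , refl ; (there m) → sound m })
  λ { ([] , _ , e) → here e ; (x ∷ w , s≤s l , e) → there (complete x w l e) }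
  where
  W : Tree
  W = value wordsPR (A ∷ encodeℕ n ∷ [])
  extend : PR 7
  extend = mapPR (var 1F ∙ var 0F) (var 1F)
  ρ : Vec Tree 6
  ρ = W ∷ nil ∷ encodeℕ n ∷ (nil ∙ encodeℕ n) ∷ A ∷ encodeℕ (suc n) ∷ []
  longer : ∀ {v} → v ∈ spine (value (concatMapPR extend (var 4F)) ρ) ⇔ _
  longer = ∈-concatMapPR extend (var 4F) ρ
  extended : ∀ {a v} → v ∈ spine (value extend (a ∷ ρ)) ⇔ _
  extended {a} = ∈-mapPR (var 1F ∙ var 0F) (var 1F) (a ∷ ρ)
  sound : v ∈ spine (value (concatMapPR extend (var 4F)) ρ) →
          ∃[ w ] length w ≤ suc n × v ≡ encodeWord enc w
  sound m
    with a , a∈ , v∈ ← to longer m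
    with b , b∈ , refl ← to extended v∈
    with x , refl ← to (lists a) a∈
    with w , l , refl ← to (∈-words lists n b) b∈
    = x ∷ w , s≤s l , refl
  complete : ∀ x w → length w ≤ n → v ≡ encodeWord enc (x ∷ w) →
             v ∈ spine (value (concatMapPR extend (var 4F)) ρ)
  complete x w l e =
    from longer (_ , from (lists (enc x)) (x , refl) ,
                 from extended (_ , from (∈-words lists n _) (w , l , refl) , e))

-- Deletions in words

infix 4 _⟶_ _⟶*_

data _⟶_ {X : Set} : List X → List X → Set where
  drop : ∀ u {a v} → a ∈ u → a ∈ v → u ++ a ∷ v ⟶ u ++ v

_⟶*_ : {X : Set} → List X → List X → Set
_⟶*_ = Star _⟶_

∷-⟶ : {X : Set} (a : X) {v w : List X} → v ⟶ w → a ∷ v ⟶ a ∷ w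
∷-⟶ a (drop u p q) = drop (a ∷ u) (there p) q

map-⟶ : {X Y : Set} (f : X → Y) {v w : List X} → v ⟶ w → List.map f v ⟶ List.map f w
map-⟶ f (drop u {a} {v} p q) = subst₂ _⟶_ (sym (map-++ f u (a ∷ v))) (sym (map-++ f u v))
  (drop (List.map f u) (∈-map⁺ f p) (∈-map⁺ f q))

labels-⟶* : {X Y : Set} {σ τ : List (X × Y)} → σ ⟶* τ → List.map proj₂ σ ⟶* List.map proj₂ τ
labels-⟶* = Star.gmap (List.map proj₂) (map-⟶ proj₂)

module _ {X : Set} {R : X → X → Set} where

  All-insert : ∀ {P : X → Set} u {a v} → P a → All P (u ++ v) → All P (u ++ a ∷ v)
  All-insert []      pa ps       = pa ∷ ps
  All-insert (x ∷ u) pa (p ∷ ps) = p ∷ All-insert u pa ps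

  All-remove : ∀ {P : X → Set} u {a v} → All P (u ++ a ∷ v) → All P (u ++ v)
  All-remove []      (_ ∷ ps) = ps
  All-remove (x ∷ u) (p ∷ ps) = p ∷ All-remove u ps

  AllPairs-remove : ∀ u {a v} → AllPairs R (u ++ a ∷ v) → AllPairs R (u ++ v)
  AllPairs-remove []      (_ ∷ ps) = ps
  AllPairs-remove (x ∷ u) (p ∷ ps) = All-remove u p ∷ AllPairs-remove u ps

  AllPairs-before : ∀ u {a v} → a ∈ u → AllPairs R (u ++ v) → All (R a) v
  AllPairs-before (x ∷ u) (here refl) (p ∷ _) = ++⁻ʳ u p
  AllPairs-before (x ∷ u) (there a∈u) (_ ∷ ps) = AllPairs-before u a∈u ps

  AllPairs-insert : ∀ u {a v} → All (R a) v → a ∈ v → AllPairs R (u ++ v) → AllPairs R (u ++ a ∷ v)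
  AllPairs-insert []      r a∈v ps       = r ∷ ps
  AllPairs-insert (x ∷ u) r a∈v (p ∷ ps) =
    All-insert u (All.lookup p (∈-++⁺ʳ u a∈v)) p ∷ AllPairs-insert u r a∈v ps

  AllPairs-⟶ : ∀ {v w} → v ⟶ w → AllPairs R v → AllPairs R w
  AllPairs-⟶ (drop u _ _) = AllPairs-remove u

  -- The surviving copies vouch for the inserted one: what stands before it is already related to
  -- the later copy, and the earlier copy is already related to what stands after it. The relation
  -- between the two copies gives the condition of `a` against itself, so `R` may be any relation.
  AllPairs-⟵ : ∀ {v w} → v ⟶ w → AllPairs R w → AllPairs R v
  AllPairs-⟵ (drop u p q) ps = AllPairs-insert u (AllPairs-before u p ps) q ps

  AllPairs-⟶* : ∀ {v w} → v ⟶* w → AllPairs R v → AllPairs R w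
  AllPairs-⟶* ε        = id
  AllPairs-⟶* (s ◅ ss) = AllPairs-⟶* ss ∘ AllPairs-⟶ s

  AllPairs-⟵* : ∀ {v w} → v ⟶* w → AllPairs R w → AllPairs R v
  AllPairs-⟵* ε        = id
  AllPairs-⟵* (s ◅ ss) = AllPairs-⟵ s ∘ AllPairs-⟵* ss

module Occurrences {X : Set} (_≟_ : DecidableEquality X) where
  open DecMembership _≟_ using (_∈?_)

  occ : X → List X → ℕ
  occ x []      = 0
  occ x (y ∷ w) with x ≟ y
  ... | yes _ = suc (occ x w)
  ... | no  _ = occ x w

  without : X → List X → List X
  without x []      = []
  without x (y ∷ w) with x ≟ y
  ... | yes _ = without x w
  ... | no  _ = y ∷ without x w

  length-without : ∀ x w → length w ≡ occ x w + length (without x w)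
  length-without x []      = refl
  length-without x (y ∷ w) with x ≟ y
  ... | yes _ = cong suc (length-without x w)
  ... | no  _ = trans (cong suc (length-without x w)) (sym (+-suc (occ x w) _))

  occ-without : ∀ x y w → occ y (without x w) ≤ occ y w
  occ-without x y []      = z≤n
  occ-without x y (z ∷ w) with x ≟ z
  ... | no _ with y ≟ z
  ...   | yes _ = s≤s (occ-without x y w)
  ...   | no  _ = occ-without x y w
  occ-without x y (z ∷ w) | yes _ with y ≟ z
  ...   | yes _ = m≤n⇒m≤1+n (occ-without x y w)
  ...   | no  _ = occ-without x y w

  All-without : ∀ x xs w → All (_∈ x ∷ xs) w → All (_∈ xs) (without x w)
  All-without x xs []      []       = []
  All-without x xs (y ∷ w) (p ∷ ps) with x ≟ y | p
  ... | yes _  | _          = All-without x xs w ps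
  ... | no x≢y | here refl  = ⊥-elim (x≢y refl)
  ... | no x≢y | there y∈xs = y∈xs ∷ All-without x xs w ps

  -- Induction on the alphabet: all occurrences of one letter are split off at a time.
  length-bounded : ∀ xs c w → All (_∈ xs) w → (∀ x → occ x w ≤ c) → length w ≤ length xs * c
  length-bounded []       c []      []       h = z≤n
  length-bounded []       c (_ ∷ _) (() ∷ _) h
  length-bounded (x ∷ xs) c w       ps       h =
    ≤-trans (≤-reflexive (length-without x w))
      (+-mono-≤ (h x) (length-bounded xs c (without x w) (All-without x xs w ps)
                        (λ y → ≤-trans (occ-without x y w) (h y))))

  occ-∉ : ∀ {x} w → x ∉ w → occ x w ≡ 0
  occ-∉ []      x∉ = refl
  occ-∉ {x} (y ∷ w) x∉ with x ≟ y
  ... | yes x≡y = ⊥-elim (x∉ (here x≡y))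
  ... | no  _   = occ-∉ w (x∉ ∘ there)

  delete : X → List X → List X
  delete a []      = []
  delete a (b ∷ w) = if does (b ≟ a) ∧ does (a ∈? w) then w else b ∷ delete a w

  reduce : List X → List X
  reduce []      = []
  reduce (a ∷ w) = a ∷ delete a (reduce w)

  delete-cases : ∀ a w → delete a w ≡ w ⊎
                 (∃[ u ] ∃[ v ] w ≡ u ++ a ∷ v × a ∈ v × delete a w ≡ u ++ v)
  delete-cases a []      = inj₁ refl
  delete-cases a (b ∷ w) with b ≟ a | a ∈? w | delete-cases a w
  ... | yes refl | yes a∈w | _ = inj₂ ([] , w , refl , a∈w , refl)
  ... | yes _ | no _ | inj₁ e = inj₁ (cong (b ∷_) e)
  ... | yes _ | no _ | inj₂ (u , v , e , m , e′) = inj₂ (b ∷ u , v , cong (b ∷_) e , m , cong (b ∷_) e′)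
  ... | no _  | _    | inj₁ e = inj₁ (cong (b ∷_) e)
  ... | no _  | _    | inj₂ (u , v , e , m , e′) = inj₂ (b ∷ u , v , cong (b ∷_) e , m , cong (b ∷_) e′)

  reduces : ∀ w → w ⟶* reduce w
  reduces []      = ε
  reduces (a ∷ w) = Star.gmap (a ∷_) (∷-⟶ a) (reduces w) ◅◅ last (delete-cases a (reduce w))
    where
    last : delete a (reduce w) ≡ reduce w ⊎ _ → a ∷ reduce w ⟶* a ∷ delete a (reduce w)
    last (inj₁ e) = subst (λ v → a ∷ reduce w ⟶* a ∷ v) (sym e) ε
    last (inj₂ (u , v , e , m , e′)) =
      -- The `a` put in front is the earlier copy that `drop` requires; the later one is `m`.
      subst₂ (λ v w → a ∷ v ⟶* a ∷ w) (sym e) (sym e′) (drop (a ∷ u) (here refl) m ◅ ε)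

  occ-delete : ∀ a x w → occ x (delete a w) ≤ occ x w
  occ-delete a x []      = z≤n
  occ-delete a x (b ∷ w) with b ≟ a | a ∈? w
  occ-delete a x (b ∷ w) | yes _ | yes _ with x ≟ b
  ... | yes _ = n≤1+n _
  ... | no  _ = ≤-refl
  occ-delete a x (b ∷ w) | yes _ | no _ with x ≟ b
  ... | yes _ = s≤s (occ-delete a x w)
  ... | no  _ = occ-delete a x w
  occ-delete a x (b ∷ w) | no _ | _ with x ≟ b
  ... | yes _ = s≤s (occ-delete a x w)
  ... | no  _ = occ-delete a x w

  occ-delete-same : ∀ a w → occ a w ≤ 2 → occ a (delete a w) ≤ 1
  occ-delete-same a []      h = z≤n
  occ-delete-same a (b ∷ w) h with b ≟ a | a ∈? w
  occ-delete-same a (b ∷ w) h | yes refl | yes _ with a ≟ a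
  ... | yes _   = ≤-pred h
  ... | no a≢a = ⊥-elim (a≢a refl)
  occ-delete-same a (b ∷ w) h | yes refl | no a∉w with a ≟ a
  ... | yes _   = s≤s (≤-trans (occ-delete a a w) (≤-reflexive (occ-∉ w a∉w)))
  ... | no a≢a = ⊥-elim (a≢a refl)
  occ-delete-same a (b ∷ w) h | no b≢a | _ with a ≟ b
  ... | yes a≡b = ⊥-elim (b≢a (sym a≡b))
  ... | no _    = occ-delete-same a w h

  occ-reduce : ∀ x w → occ x (reduce w) ≤ 2
  occ-reduce x []      = z≤n
  occ-reduce x (a ∷ w) with x ≟ a
  ... | yes refl = s≤s (occ-delete-same a (reduce w) (occ-reduce a w))
  ... | no _     = ≤-trans (occ-delete a x (reduce w)) (occ-reduce x w)

-- Words over Fin p × Fin k and their projections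

module _ {p : ℕ} {Y : Set} where

  proj : Fin p → List (Fin p × Y) → List Y
  proj x []            = []
  proj x ((y , ℓ) ∷ τ) with x Fin.≟ y
  ... | yes _ = ℓ ∷ proj x τ
  ... | no  _ = proj x τ

  open Occurrences (Fin._≟_ {p}) using (occ)

  length-proj : ∀ x τ → length (proj x τ) ≡ occ x (List.map proj₁ τ)
  length-proj x []            = refl
  length-proj x ((y , ℓ) ∷ τ) with x Fin.≟ y
  ... | yes _ = cong suc (length-proj x τ)
  ... | no  _ = length-proj x τ

  proj-++ : ∀ x σ τ → proj x (σ ++ τ) ≡ proj x σ ++ proj x τ
  proj-++ x []            τ = refl
  proj-++ x ((y , ℓ) ∷ σ) τ with x Fin.≟ y
  ... | yes _ = cong (ℓ ∷_) (proj-++ x σ τ)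
  ... | no  _ = proj-++ x σ τ

  proj-here : ∀ x ℓ τ → proj x ((x , ℓ) ∷ τ) ≡ ℓ ∷ proj x τ
  proj-here x ℓ τ with x Fin.≟ x
  ... | yes _   = refl
  ... | no  x≢x = ⊥-elim (x≢x refl)

  proj-there : ∀ {x y} ℓ τ → x ≢ y → proj x ((y , ℓ) ∷ τ) ≡ proj x τ
  proj-there {x} {y} ℓ τ x≢y with x Fin.≟ y
  ... | yes x≡y = ⊥-elim (x≢y x≡y)
  ... | no  _   = refl

  ∈-proj : ∀ {x ℓ} τ → ℓ ∈ proj x τ → (x , ℓ) ∈ τ
  ∈-proj {x} ((y , _) ∷ τ) m with x Fin.≟ y
  ∈-proj ((y , _) ∷ τ) (here refl) | yes refl = here refl
  ∈-proj ((y , _) ∷ τ) (there m)   | yes refl = there (∈-proj τ m)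
  ∈-proj ((y , _) ∷ τ) m           | no  _    = there (∈-proj τ m)

  proj-split : ∀ x u {v} τ → proj x τ ≡ u ++ v →
               ∃[ τ₁ ] ∃[ τ₂ ] τ ≡ τ₁ ++ τ₂ × proj x τ₁ ≡ u × proj x τ₂ ≡ v
  proj-split x []      τ e = [] , τ , refl , refl , e
  proj-split x (a ∷ u) ((y , ℓ) ∷ τ) e with x Fin.≟ y
  ... | yes refl with τ₁ , τ₂ , refl , e₁ , e₂ ← proj-split x u τ (∷-injectiveʳ e) =
    (x , ℓ) ∷ τ₁ , τ₂ , refl , trans (proj-here x ℓ τ₁) (cong₂ _∷_ (∷-injectiveˡ e) e₁) , e₂
  ... | no x≢y with τ₁ , τ₂ , refl , e₁ , e₂ ← proj-split x (a ∷ u) τ e =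
    (y , ℓ) ∷ τ₁ , τ₂ , refl , trans (proj-there ℓ τ₁ x≢y) e₁ , e₂

  proj-split-at : ∀ x {a v} τ → proj x τ ≡ a ∷ v →
                  ∃[ τ₁ ] ∃[ τ₂ ] τ ≡ τ₁ ++ (x , a) ∷ τ₂ × proj x τ₁ ≡ [] × proj x τ₂ ≡ v
  proj-split-at x ((y , ℓ) ∷ τ) e with x Fin.≟ y
  proj-split-at x ((y , ℓ) ∷ τ) refl | yes refl = [] , τ , refl , refl , refl
  proj-split-at x ((y , ℓ) ∷ τ) e    | no x≢y
    with τ₁ , τ₂ , refl , e₁ , e₂ ← proj-split-at x τ e =
    (y , ℓ) ∷ τ₁ , τ₂ , refl , trans (proj-there ℓ τ₁ x≢y) e₁ , e₂

  proj-insert : ∀ {x y} → y ≢ x → ∀ τ₁ τ₂ ℓ → proj y (τ₁ ++ (x , ℓ) ∷ τ₂) ≡ proj y (τ₁ ++ τ₂)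
  proj-insert {x} {y} y≢x τ₁ τ₂ ℓ = trans (proj-++ y τ₁ _)
    (trans (cong (proj y τ₁ ++_) (proj-there ℓ τ₂ y≢x)) (sym (proj-++ y τ₁ τ₂)))

  AgreeOff : Fin p → List (Fin p × Y) → List (Fin p × Y) → Set
  AgreeOff x τ τ′ = ∀ y → y ≢ x → proj y τ ≡ proj y τ′

  -- The deleted letter may return at any cut of τ between the parts projecting to `u` and to `v`:
  -- its copies there are copies of the item (x , a) in τ, so the same deletion is a step on items.
  expand-⟶ : ∀ x {v w} τ → w ⟶ v → proj x τ ≡ v →
             ∃[ τ′ ] τ′ ⟶ τ × proj x τ′ ≡ w × AgreeOff x τ′ τ
  expand-⟶ x τ (drop u {a} p q) e with τ₁ , τ₂ , refl , refl , refl ← proj-split x u τ e =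
    τ₁ ++ (x , a) ∷ τ₂ , drop τ₁ (∈-proj τ₁ p) (∈-proj τ₂ q) ,
    trans (proj-++ x τ₁ _) (cong (proj x τ₁ ++_) (proj-here x a τ₂)) ,
    λ y y≢x → proj-insert y≢x τ₁ τ₂ a

  contract-⟶ : ∀ x {v w} τ → w ⟶ v → proj x τ ≡ w →
               ∃[ τ′ ] τ ⟶ τ′ × proj x τ′ ≡ v × AgreeOff x τ τ′
  contract-⟶ x τ (drop u {a} p q) e
    with τ₁ , τ₂ , refl , refl , e₂ ← proj-split x u τ e
    -- Entries of other operands may stand between the cut and the deleted letter; `τ₃` collects
    -- them.
    with τ₃ , τ₄ , refl , e₃ , refl ← proj-split-at x τ₂ e₂ =
    (τ₁ ++ τ₃) ++ τ₄ ,
    subst (_⟶ _) (++-assoc τ₁ τ₃ _) (drop (τ₁ ++ τ₃) (∈-++⁺ˡ (∈-proj τ₁ p)) (∈-proj τ₄ q)) ,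
    trans (proj-++ x (τ₁ ++ τ₃) τ₄) (cong (_++ proj x τ₄) (trans (proj-++ x τ₁ τ₃)
      (trans (cong (proj x τ₁ ++_) e₃) (++-identityʳ _)))) ,
    λ y y≢x → trans (cong (proj y) (sym (++-assoc τ₁ τ₃ _))) (proj-insert y≢x (τ₁ ++ τ₃) τ₄ a)

  expand : ∀ x τ {w} → w ⟶* proj x τ → ∃[ τ′ ] τ′ ⟶* τ × proj x τ′ ≡ w × AgreeOff x τ′ τ
  expand x τ s = go s refl
    where
    go : ∀ {v w} → w ⟶* v → proj x τ ≡ v → ∃[ τ′ ] τ′ ⟶* τ × proj x τ′ ≡ w × AgreeOff x τ′ τ
    go ε        e = τ , ε , e , λ _ _ → refl
    go (s ◅ ss) e
      with τ₁ , s₁ , e₁ , f₁ ← go ss e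
      with τ₂ , s₂ , e₂ , f₂ ← expand-⟶ x τ₁ s e₁ =
      τ₂ , s₂ ◅ s₁ , e₂ , λ y y≢x → trans (f₂ y y≢x) (f₁ y y≢x)

  contract : ∀ x τ {v} → proj x τ ⟶* v → ∃[ τ′ ] τ ⟶* τ′ × proj x τ′ ≡ v × AgreeOff x τ′ τ
  contract x τ s = go s τ refl
    where
    go : ∀ {v w} → w ⟶* v → ∀ τ → proj x τ ≡ w → ∃[ τ′ ] τ ⟶* τ′ × proj x τ′ ≡ v × AgreeOff x τ′ τ
    go ε        τ e = τ , ε , e , λ _ _ → refl
    go (s ◅ ss) τ e
      with τ₁ , s₁ , e₁ , f₁ ← contract-⟶ x τ s e
      with τ₂ , s₂ , e₂ , f₂ ← go ss τ₁ e₁ =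
      τ₂ , s₁ ◅ s₂ , e₂ , λ y y≢x → trans (f₂ y y≢x) (sym (f₁ y y≢x))

  module _ (_⇝_ : ∀ {X : Set} → List X → List X → Set)
           (⇝-refl : ∀ {τ : List (Fin p × Y)} → τ ⇝ τ)
           (⇝-trans : ∀ {ρ σ τ : List (Fin p × Y)} → ρ ⇝ σ → σ ⇝ τ → ρ ⇝ τ)
           (lift : ∀ x τ {v} → proj x τ ⇝ v → ∃[ τ′ ] τ ⇝ τ′ × proj x τ′ ≡ v × AgreeOff x τ′ τ)
           (τ : List (Fin p × Y)) (goal : Fin p → List Y) (steps : ∀ x → proj x τ ⇝ goal x)
           where

    open DecMembership (Fin._≟_ {p}) using (_∈?_)

    -- Operands are treated one after another; the last clause keeps the projections to untreated
    -- operands as they were in τ, so that their given reductions still apply. The relation is a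
    -- parameter because the same argument serves deletion and, with the arrow reversed, insertion.
    along : ∀ is → ∃[ τ′ ] τ ⇝ τ′ × (∀ x → x ∈ is → proj x τ′ ≡ goal x) ×
                                    (∀ x → x ∉ is → proj x τ′ ≡ proj x τ)
    along []       = τ , ⇝-refl , (λ _ ()) , λ _ _ → refl
    along (i ∷ is) with along is | i ∈? is
    -- A repeated operand has already reached its goal and must not be lifted again.
    ... | τ₁ , s₁ , e₁ , f₁ | yes i∈is =
      τ₁ , s₁ , (λ { x (here refl) → e₁ x i∈is ; x (there m) → e₁ x m }) ,
      λ x x∉ → f₁ x (x∉ ∘ there)
    ... | τ₁ , s₁ , e₁ , f₁ | no i∉is
      with τ₂ , s₂ , e₂ , f₂ ← lift i τ₁ (subst (_⇝ goal i) (sym (f₁ i i∉is)) (steps i)) =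
      τ₂ , ⇝-trans s₁ s₂ ,
      (λ { x (here refl) → e₂
         ; x (there m) → trans (f₂ x (λ { refl → i∉is m })) (e₁ x m) }) ,
      λ x x∉ → trans (f₂ x (x∉ ∘ here)) (f₁ x (x∉ ∘ there))

    lift-all : ∃[ τ′ ] τ ⇝ τ′ × ∀ x → proj x τ′ ≡ goal x
    lift-all = let τ′ , s , e , _ = along (allFin p) in τ′ , s , λ x → e x (∈-allFin x)

  expand-all : ∀ τ (w : Fin p → List Y) → (∀ x → w x ⟶* proj x τ) →
               ∃[ τ′ ] τ′ ⟶* τ × ∀ x → proj x τ′ ≡ w x
  expand-all = lift-all (flip _⟶*_) ε (flip _◅◅_) expand

  contract-all : ∀ τ (v : Fin p → List Y) → (∀ x → proj x τ ⟶* v x) →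
                 ∃[ τ′ ] τ ⟶* τ′ × ∀ x → proj x τ′ ≡ v x
  contract-all = lift-all _⟶*_ ε _◅◅_ contract

-- Arrangements and their words

-- The arc with label set L may lead from a vertex labeled ℓ to a later one
-- labeled ℓ′.
Free : ∀ {k} → Maybe (LabelSet k) → Fin k → Fin k → Set
Free nothing        ℓ ℓ′ = ⊤
Free (just (a , b)) ℓ ℓ′ = ¬ T (Vec.lookup a ℓ) × ¬ T (Vec.lookup b ℓ′)

-- With `u ≢ v` inside the relation, `AllPairs` also excludes repeated vertices; together with
-- coverage it makes a list an ordering of the vertex set.
Precedes : ∀ {k} (G : LabeledDigraph k) → V G × Fin k → V G × Fin k → Set
Precedes G (u , ℓ) (v , ℓ′) = u ≢ v × Free (arc G u v) ℓ ℓ′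

Arrangement : ∀ {k} (G : LabeledDigraph k) → List (V G × Fin k) → Set
Arrangement G xs = AllPairs (Precedes G) xs × (∀ v → v ∈ List.map proj₁ xs)

HasWord : ∀ {k} → LabeledDigraph k → List (Fin k) → Set
HasWord G w = ∃[ xs ] Arrangement G xs × List.map proj₂ xs ≡ w

module _ {k} {G H : LabeledDigraph k} (φ : V G ↔ V H)
         (agree : ∀ u v → arc G u v ≡ arc H (Inverse.to φ u) (Inverse.to φ v)) where
  open Inverse φ using (strictlyInverseˡ; strictlyInverseʳ) renaming (to to φ⁺; from to φ⁻)

  relabel : ∀ {w} → HasWord G w → HasWord H w
  relabel {w} (xs , (ps , covers) , refl) =
    List.map (map₁ φ⁺) xs ,
    (AllPairsP.map⁺ (AllPairs.map precedes ps) , cover) ,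
    sym (map-∘ xs)
    where
    precedes : ∀ {x y} → Precedes G x y → Precedes H (map₁ φ⁺ x) (map₁ φ⁺ y)
    precedes {u , ℓ} {v , ℓ′} (u≢v , free) =
      u≢v ∘ injective , subst (λ L → Free L ℓ ℓ′) (agree u v) free
      where
      injective : φ⁺ u ≡ φ⁺ v → u ≡ v
      injective e = trans (sym (strictlyInverseʳ u)) (trans (cong φ⁻ e) (strictlyInverseʳ v))
    cover : ∀ v → v ∈ List.map proj₁ (List.map (map₁ φ⁺) xs)
    cover v = subst (v ∈_) (trans (sym (map-∘ xs)) (map-∘ xs))
      (subst (_∈ List.map φ⁺ (List.map proj₁ xs)) (strictlyInverseˡ v) (∈-map⁺ φ⁺ (covers (φ⁻ v))))

relabel-⇔ : ∀ {k} {G H : LabeledDigraph k} (φ : V G ↔ V H) →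
            (∀ u v → arc G u v ≡ arc H (Inverse.to φ u) (Inverse.to φ v)) →
            ∀ {w} → HasWord G w ⇔ HasWord H w
relabel-⇔ {G = G} {H} φ agree = mk⇔ (relabel {G = G} {H} φ agree)
  (relabel {G = H} {G} (↔-sym φ) λ u v →
    sym (trans (agree (Inverse.from φ u) (Inverse.from φ v))
               (cong₂ (arc H) (Inverse.strictlyInverseˡ φ u) (Inverse.strictlyInverseˡ φ v))))

-- Splitting and interleaving arrangements of a substitution

module _ {p : ℕ} {W : Fin p → Set} {L : Set} where

  restrict : ∀ x → List (Σ (Fin p) W × L) → List (W x × L)
  restrict x []                   = []
  restrict x (((y , u) , ℓ) ∷ xs) with x Fin.≟ y
  ... | yes refl = (u , ℓ) ∷ restrict x xs
  ... | no  _    = restrict x xs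

  tag : Σ (Fin p) W × L → Fin p × L
  tag ((x , _) , ℓ) = x , ℓ

  labels-restrict : ∀ x xs → List.map proj₂ (restrict x xs) ≡ proj x (List.map tag xs)
  labels-restrict x []                   = refl
  labels-restrict x (((y , u) , ℓ) ∷ xs) with x Fin.≟ y
  ... | yes refl = cong (ℓ ∷_) (labels-restrict x xs)
  ... | no  _    = labels-restrict x xs

  ∈-restrict : ∀ {x u ℓ} xs → ((x , u) , ℓ) ∈ xs → (u , ℓ) ∈ restrict x xs
  ∈-restrict {x} (((y , v) , ℓ) ∷ xs) m with x Fin.≟ y
  ∈-restrict (_ ∷ xs) (here refl) | yes refl = here refl
  ∈-restrict (_ ∷ xs) (there m)   | yes refl = there (∈-restrict xs m)
  ∈-restrict (_ ∷ xs) (here refl) | no x≢x   = ⊥-elim (x≢x refl)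
  ∈-restrict (_ ∷ xs) (there m)   | no _     = ∈-restrict xs m

  ∈-restrict⁻ : ∀ {x u ℓ} xs → (u , ℓ) ∈ restrict x xs → ((x , u) , ℓ) ∈ xs
  ∈-restrict⁻ {x} (((y , v) , ℓ) ∷ xs) m with x Fin.≟ y
  ∈-restrict⁻ (_ ∷ xs) (here refl) | yes refl = here refl
  ∈-restrict⁻ (_ ∷ xs) (there m)   | yes refl = there (∈-restrict⁻ xs m)
  ∈-restrict⁻ (_ ∷ xs) m           | no _     = there (∈-restrict⁻ xs m)

  AllPairs-restrict : ∀ {R : Σ (Fin p) W × L → Σ (Fin p) W × L → Set} x {xs} → AllPairs R xs →
                      AllPairs (λ (u , ℓ) (v , ℓ′) → R ((x , u) , ℓ) ((x , v) , ℓ′)) (restrict x xs)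
  AllPairs-restrict x {[]} [] = []
  AllPairs-restrict x {((y , u) , ℓ) ∷ xs} (p ∷ ps) with x Fin.≟ y
  ... | yes refl = All.tabulate (λ m → All.lookup p (∈-restrict⁻ xs m)) ∷ AllPairs-restrict x ps
  ... | no  _    = AllPairs-restrict x ps

  -- Two entries from different operands are compared through their tags; two from the same operand
  -- meet again in its restriction.
  AllPairs-restrict⁻ : ∀ {R : Σ (Fin p) W × L → Σ (Fin p) W × L → Set}
                         {Q : Fin p × L → Fin p × L → Set} →
    (∀ {x y u v ℓ ℓ′} → x ≢ y → Q (x , ℓ) (y , ℓ′) → R ((x , u) , ℓ) ((y , v) , ℓ′)) →
    ∀ xs → AllPairs Q (List.map tag xs) →
    (∀ x → AllPairs (λ (u , ℓ) (v , ℓ′) → R ((x , u) , ℓ) ((x , v) , ℓ′)) (restrict x xs)) →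
    AllPairs R xs
  AllPairs-restrict⁻ across []                   []       rs = []
  AllPairs-restrict⁻ {R} across (((x , u) , ℓ) ∷ xs) (q ∷ qs) rs =
    All.tabulate first ∷ AllPairs-restrict⁻ across xs qs rest
    where
    first : ∀ {z} → z ∈ xs → R ((x , u) , ℓ) z
    first {(y , v) , ℓ′} m with x Fin.≟ y | rs x
    ... | no  x≢y  | _ = across x≢y (All.lookup q (∈-map⁺ tag m))
    ... | yes refl | r with x Fin.≟ x
    ...   | no  x≢x  = ⊥-elim (x≢x refl)
    ...   | yes refl with s ∷ _ ← r = All.lookup s (∈-restrict xs m)
    rest : ∀ y → AllPairs _ (restrict y xs)
    rest y with y Fin.≟ x | rs y
    ... | yes refl | _ ∷ r = r
    ... | no  _    | r     = r

  -- τ dictates which operand comes next: each letter (x , ℓ) takes the first remaining entry of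
  -- `xs x`, whose label is ℓ because the words agree.
  interleave : ∀ τ (xs : ∀ x → List (W x × L)) → (∀ x → List.map proj₂ (xs x) ≡ proj x τ) →
               ∃[ zs ] List.map tag zs ≡ τ × ∀ x → restrict x zs ≡ xs x
  interleave []            xs e = [] , refl , λ x → sym (empty (xs x) (e x))
    where
    empty : ∀ {X : Set} (ys : List (X × L)) → List.map proj₂ ys ≡ [] → ys ≡ []
    empty [] _ = refl
  interleave ((x , ℓ) ∷ τ) xs e = add (xs x) refl (trans (e x) (proj-here x ℓ τ))
    where
    add : ∀ ys → xs x ≡ ys → List.map proj₂ ys ≡ ℓ ∷ proj x τ →
          ∃[ zs ] List.map tag zs ≡ (x , ℓ) ∷ τ × ∀ x → restrict x zs ≡ xs x
    add ((u , _) ∷ ys) xs≡ e′ with refl ← ∷-injectiveˡ e′ = conclude (interleave τ shorter labels)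
      where
      shorter : ∀ y → List (W y × L)
      shorter y with x Fin.≟ y
      ... | yes refl = ys
      ... | no  _    = xs y
      labels : ∀ y → List.map proj₂ (shorter y) ≡ proj y τ
      labels y with x Fin.≟ y
      ... | yes refl = ∷-injectiveʳ e′
      ... | no  x≢y  = trans (e y) (proj-there ℓ τ (x≢y ∘ sym))
      conclude : ∃[ zs ] List.map tag zs ≡ τ × (∀ y → restrict y zs ≡ shorter y) →
                 ∃[ zs ] List.map tag zs ≡ (x , ℓ) ∷ τ × ∀ x → restrict x zs ≡ xs x
      conclude (zs , t , r) = ((x , u) , ℓ) ∷ zs , cong ((x , ℓ) ∷_) t , restricted
        where
        restricted : ∀ y → restrict y (((x , u) , ℓ) ∷ zs) ≡ xs y
        restricted y with y Fin.≟ x | x Fin.≟ y | r y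
        ... | yes refl | yes refl | r′ = trans (cong ((u , ℓ) ∷_) r′) (sym xs≡)
        ... | yes refl | no  x≢x  | _  = ⊥-elim (x≢x refl)
        ... | no  y≢x  | yes refl | _  = ⊥-elim (y≢x refl)
        ... | no  _    | no  _    | r′ = r′

FreeItems : ∀ {k p} → (Fin p → Fin p → Maybe (LabelSet k)) → Fin p × Fin k → Fin p × Fin k → Set
FreeItems t (x , ℓ) (y , ℓ′) = Free (t x y) ℓ ℓ′

module _ {k p} (2≤p : 2 ≤ p) (t : Fin p → Fin p → Maybe (LabelSet k))
         (loopless : ∀ x → t x x ≡ nothing) (es : Fin p → Expr k) where

  private
    S : Expr k
    S = substitute 2≤p t loopless es

    arcs-within : ∀ x u v → arcs S (x , u) (x , v) ≡ arcs (es x) u v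
    arcs-within x u v with x Fin.≟ x
    ... | yes refl = refl
    ... | no  x≢x  = ⊥-elim (x≢x refl)

    arcs-across : ∀ {x y} u v → x ≢ y → arcs S (x , u) (y , v) ≡ t x y
    arcs-across {x} {y} u v x≢y with x Fin.≟ y
    ... | yes x≡y = ⊥-elim (x≢y x≡y)
    ... | no  _   = refl

  substitute-split : ∀ {w} → HasWord ⟦ S ⟧ w →
    ∃[ τ ] AllPairs (FreeItems t) τ × (∀ x → HasWord ⟦ es x ⟧ (proj x τ)) × List.map proj₂ τ ≡ w
  substitute-split (xs , (ps , covers) , refl) =
    List.map tag xs , AllPairsP.map⁺ (AllPairs.map free ps) ,
    (λ x → restrict x xs , (AllPairs.map (within x) (AllPairs-restrict x ps) , cover x) ,
           labels-restrict x xs) ,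
    sym (map-∘ xs)
    where
    free : ∀ {a b} → Precedes ⟦ S ⟧ a b → FreeItems t (tag a) (tag b)
    free {(x , u) , ℓ} {(y , v) , ℓ′} (_ , f) with x Fin.≟ y
    -- A loopless template imposes nothing on entries of the same operand; their condition is
    -- handled by `within`.
    ... | yes refl rewrite loopless x = tt
    ... | no  _    = f
    within : ∀ x {a b} → Precedes ⟦ S ⟧ (map₁ (x ,_) a) (map₁ (x ,_) b) → Precedes ⟦ es x ⟧ a b
    within x {u , ℓ} {v , ℓ′} (≢ , f) =
      (λ { refl → ≢ refl }) , subst (λ L → Free L ℓ ℓ′) (arcs-within x u v) f
    cover : ∀ x v → v ∈ List.map proj₁ (restrict x xs)
    cover x v with (_ , ℓ) , m , refl ← ∈-map⁻ proj₁ (covers (x , v)) =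
      ∈-map⁺ proj₁ (∈-restrict {ℓ = ℓ} xs m)

  substitute-join : ∀ τ → AllPairs (FreeItems t) τ → (∀ x → HasWord ⟦ es x ⟧ (proj x τ)) →
                    HasWord ⟦ S ⟧ (List.map proj₂ τ)
  substitute-join τ free words
    with zs , refl , r ← interleave τ (λ x → proj₁ (words x)) (λ x → proj₂ (proj₂ (words x))) =
    zs , (AllPairs-restrict⁻ across zs free (λ x → AllPairs.map (within x) (inside x)) , cover) ,
    map-∘ zs
    where
    inside : ∀ x → AllPairs (Precedes ⟦ es x ⟧) (restrict x zs)
    inside x = subst (AllPairs _) (sym (r x)) (proj₁ (proj₁ (proj₂ (words x))))
    across : ∀ {x y u v ℓ ℓ′} → x ≢ y → FreeItems t (x , ℓ) (y , ℓ′) →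
             Precedes ⟦ S ⟧ ((x , u) , ℓ) ((y , v) , ℓ′)
    across {u = u} {v} {ℓ} {ℓ′} x≢y f =
      (λ { refl → x≢y refl }) , subst (λ L → Free L ℓ ℓ′) (sym (arcs-across u v x≢y)) f
    within : ∀ x {a b} → Precedes ⟦ es x ⟧ a b → Precedes ⟦ S ⟧ (map₁ (x ,_) a) (map₁ (x ,_) b)
    within x {u , ℓ} {v , ℓ′} (≢ , f) =
      (λ { refl → ≢ refl }) , subst (λ L → Free L ℓ ℓ′) (sym (arcs-within x u v)) f
    cover : ∀ v → v ∈ List.map proj₁ zs
    cover (x , v)
      with (_ , ℓ) , m , refl ← ∈-map⁻ proj₁ (subst (λ ys → v ∈ List.map proj₁ ys) (sym (r x))
                                               (proj₂ (proj₁ (proj₂ (words x))) v)) =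
      ∈-map⁺ proj₁ (∈-restrict⁻ zs m)

-- Disjoint union and join are substitutions into two-vertex templates.

pair : ∀ {X : Set} → X → X → Fin 2 → X
pair a b 0F = a
pair a b 1F = b

template₂ : ∀ {k} → Maybe (LabelSet k) → Maybe (LabelSet k) → Fin 2 → Fin 2 → Maybe (LabelSet k)
template₂ L L′ 0F 1F = L
template₂ L L′ 1F 0F = L′
template₂ L L′ 0F 0F = nothing
template₂ L L′ 1F 1F = nothing

loopless₂ : ∀ {k} L L′ x → template₂ {k} L L′ x x ≡ nothing
loopless₂ L L′ 0F = refl
loopless₂ L L′ 1F = refl

substitute₂ : ∀ {k} → Maybe (LabelSet k) → Maybe (LabelSet k) → Expr k → Expr k → Expr k
substitute₂ L L′ e₁ e₂ =
  substitute ≤-refl (template₂ L L′) (loopless₂ L L′) (pair e₁ e₂)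

Σ₂↔⊎ : ∀ {k} (e₁ e₂ : Expr k) → Σ (Fin 2) (Vertex ∘ pair e₁ e₂) ↔ (Vertex e₁ ⊎ Vertex e₂)
Σ₂↔⊎ e₁ e₂ = mk↔ₛ′ (λ { (0F , u) → inj₁ u ; (1F , u) → inj₂ u })
                   (λ { (inj₁ u) → 0F , u ; (inj₂ u) → 1F , u })
                   (λ { (inj₁ u) → refl ; (inj₂ u) → refl })
                   (λ { (0F , u) → refl ; (1F , u) → refl })

union-word : ∀ {k} (e₁ e₂ : Expr k) {w} →
             HasWord ⟦ substitute₂ nothing nothing e₁ e₂ ⟧ w ⇔ HasWord ⟦ union e₁ e₂ ⟧ w
union-word e₁ e₂ = relabel-⇔ (Σ₂↔⊎ e₁ e₂) λ
  { (0F , u) (0F , v) → refl ; (0F , u) (1F , v) → refl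
  ; (1F , u) (0F , v) → refl ; (1F , u) (1F , v) → refl }

join-word : ∀ {k} L (e₁ e₂ : Expr k) {w} →
            HasWord ⟦ substitute₂ (fromThis L) (fromThat L) e₁ e₂ ⟧ w ⇔ HasWord ⟦ join L e₁ e₂ ⟧ w
join-word L e₁ e₂ = relabel-⇔ (Σ₂↔⊎ e₁ e₂) λ
  { (0F , u) (0F , v) → refl ; (0F , u) (1F , v) → refl
  ; (1F , u) (0F , v) → refl ; (1F , u) (1F , v) → refl }

-- Compatible orderings as arrangements

module _ {k n} (I : Instance k n) where
  open Instance I

  -- An absent arc means that all A-bits and B-bits are false, so the trivial case of `Free` agrees
  -- with the condition on graphs as well.
  free-labeledUnion : ∀ u v ℓ ℓ′ → Free (arc (labeledUnion I) u v) ℓ ℓ′ ⇔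
                      (¬ T (A ℓ u v) × ¬ T (B ℓ′ u v))
  free-labeledUnion u v ℓ ℓ′ = by-cases (nonempty? a ⊎-dec nonempty? b)
    where
    a b : Vec Bool k
    a = Vec.tabulate (λ i → A i u v)
    b = Vec.tabulate (λ i → B i u v)

    member : ∀ (f : Fin k → Bool) i → T (f i) → Vec.tabulate f Vec.[ i ]= true
    member f i h = lookup⇒[]= i _ (trans (lookup∘tabulate f i) (to T-≡ h))

    by-cases : (d : Dec (Nonempty a ⊎ Nonempty b)) →
               Free (if does d then just (a , b) else nothing) ℓ ℓ′ ⇔ (¬ T (A ℓ u v) × ¬ T (B ℓ′ u v))
    by-cases (yes _) rewrite lookup∘tabulate (λ i → A i u v) ℓ | lookup∘tabulate (λ i → B i u v) ℓ′ =
      mk⇔ id id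
    by-cases (no none) = mk⇔
      (λ _ → (λ h → none (inj₁ (ℓ , member (λ i → A i u v) ℓ h))) ,
             (λ h → none (inj₂ (ℓ′ , member (λ i → B i u v) ℓ′ h))))
      (λ _ → tt)

  ordering-word : CompatibleOrdering I → ∃[ w ] HasWord (labeledUnion I) w
  ordering-word C = _ , List.tabulate (λ i → s i , label i) ,
    (AllPairsP.tabulate⁺-< precedes , cover) , refl
    where
    open CompatibleOrdering C
    precedes : ∀ {i j} → i Fin.< j → Precedes (labeledUnion I) (s i , label i) (s j , label j)
    precedes {i} {j} i<j =
      (λ e → FinP.<⇒≢ i<j (trans (sym (Inverse.strictlyInverseʳ ordering i))
        (trans (cong (ordering ⟨$⟩ˡ_) e) (Inverse.strictlyInverseʳ ordering j)))) ,
      from (free-labeledUnion (s i) (s j) (label i) (label j))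
        (noLaterOut i j i<j , noEarlierIn j i i<j)
    cover : ∀ v → v ∈ List.map proj₁ (List.tabulate (λ i → s i , label i))
    cover v = subst (_∈ _) (inverseʳ ordering)
      (∈-map⁺ proj₁ (∈-tabulate⁺ {f = λ i → s i , label i} (ordering ⟨$⟩ˡ v)))

  -- Positions and vertices are in bijection, which forces the list to have length n. `build` takes
  -- the length as a variable so that this equation can be matched.
  word-ordering : ∀ {w} → HasWord (labeledUnion I) w → CompatibleOrdering I
  word-ordering (xs , (ps , covers) , _) = build (↔⇒≡ positions) positions
      (λ i → proj₂ (List.lookup xs i)) λ i j i<j → proj₂ (in-order i<j ps)
    where
    in-order : ∀ {X : Set} {R : X → X → Set} {xs : List X} {i j} → i Fin.< j → AllPairs R xs →
               R (List.lookup xs i) (List.lookup xs j)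
    in-order {xs = x ∷ xs} {zero}  {suc j} _         (p ∷ _)  = All.lookup p (∈-lookup j)
    in-order {xs = x ∷ xs} {suc i} {suc j} (s≤s i<j) (_ ∷ ps) = in-order i<j ps

    vertexAt : Fin (length xs) → Fin n
    vertexAt i = proj₁ (List.lookup xs i)

    position : ∀ v → ∃[ i ] vertexAt i ≡ v
    position v with x , m , refl ← ∈-map⁻ proj₁ (covers v) =
      Any.index m , cong proj₁ (sym (lookup-index m))

    vertexAt-injective : ∀ i j → vertexAt i ≡ vertexAt j → i ≡ j
    vertexAt-injective i j e with FinP.<-cmp i j
    ... | tri< i<j _ _ = ⊥-elim (proj₁ (in-order i<j ps) e)
    ... | tri≈ _ i≡j _ = i≡j
    ... | tri> _ _ j<i = ⊥-elim (proj₁ (in-order j<i ps) (sym e))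

    positions : Fin (length xs) ↔ Fin n
    positions = mk↔ₛ′ vertexAt (proj₁ ∘ position) (proj₂ ∘ position)
      (λ i → vertexAt-injective _ i (proj₂ (position (vertexAt i))))

    build : ∀ {m} → m ≡ n → (φ : Fin m ↔ Fin n) (label : Fin m → Fin k) →
            (∀ i j → i Fin.< j → Free (arc (labeledUnion I) (Inverse.to φ i) (Inverse.to φ j))
                                      (label i) (label j)) →
            CompatibleOrdering I
    build refl φ label free = record
      { ordering    = φ
      ; label       = label
      ; noLaterOut  = λ i j i<j → proj₁ (to (free-labeledUnion _ _ _ _) (free i j i<j))
      ; noEarlierIn = λ i j j<i → proj₂ (to (free-labeledUnion _ _ _ _) (free j i j<i))
      }

-- The computation at a node

fstPR sndPR : PR 1
fstPR = case (var 0F) nil (var 0F)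
sndPR = case (var 0F) nil (var 1F)

nthPR : PR 2
nthPR = comp fstPR (fold (var 2F) (comp sndPR (var 0F ∷ [])) (var 0F) ∷ [])

private
  tails : ℕ → Tree → Tree
  tails i t = foldTree t (λ r _ _ → value sndPR (r ∷ [])) (encodeℕ i)

  -- The fold applies one tail per unit around the whole list, while the induction on the list wants
  -- the first entry stripped innermost.
  tails-suc : ∀ i x y → tails (suc i) (x ∙ y) ≡ tails i y
  tails-suc zero    x y = refl
  tails-suc (suc i) x y = cong (λ t → value sndPR (t ∷ [])) (tails-suc i x y)

value-nth-suc : ∀ i x y → value nthPR (encodeℕ (suc i) ∷ (x ∙ y) ∷ []) ≡ value nthPR (encodeℕ i ∷ y ∷ [])
value-nth-suc i x y = cong (λ t → value fstPR (t ∷ [])) (tails-suc i x y)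

value-nth-tabulate : ∀ {m} (f : Fin m → Tree) i →
                     value nthPR (encodeFin i ∷ encodeList (List.tabulate f) ∷ []) ≡ f i
value-nth-tabulate f zero    = refl
value-nth-tabulate f (suc i) = trans (value-nth-suc (toℕ i) _ _) (value-nth-tabulate (f ∘ suc) i)

value-nth-subset : ∀ {m} (a : Vec Bool m) i →
                   value nthPR (encodeFin i ∷ encodeSubset a ∷ []) ≡ encodeBool (Vec.lookup a i)
value-nth-subset (_ ∷ a) zero    = refl
value-nth-subset (_ ∷ a) (suc i) = trans (value-nth-suc (toℕ i) _ _) (value-nth-subset a i)

timesPR : PR 2
timesPR = fold nil (comp append (var 5F ∷ var 0F ∷ [])) (var 0F)

value-times : ∀ m n → value timesPR (encodeℕ m ∷ encodeℕ n ∷ []) ≡ encodeℕ (m * n)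
value-times m n = go m
  where
  go : ∀ i → foldTree nil (λ r _ _ → value append (encodeℕ n ∷ r ∷ [])) (encodeℕ i) ≡ encodeℕ (i * n)
  go zero    = refl
  go (suc i) = trans (cong (λ r → value append (encodeℕ n ∷ r ∷ [])) (go i)) (append-encodeℕ n (i * n))

-- The environment is the template, the earlier item and the later item. An absent arc frees the
-- pair at once; otherwise the earlier label is looked up among the A-bits and the later one among
-- the B-bits.
freePR : PR 3
freePR =
  case (comp nthPR (comp fstPR (var 2F ∷ []) ∷ comp nthPR (comp fstPR (var 1F ∷ []) ∷ var 0F ∷ []) ∷ []))
    (nil ∙ nil)
    (case (var 1F) nil
      (case (comp nthPR (comp sndPR (var 5F ∷ []) ∷ var 0F ∷ []))
        (case (comp nthPR (comp sndPR (var 6F ∷ []) ∷ var 1F ∷ [])) (nil ∙ nil) nil)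
        nil))

encodeTemplate : ∀ {k p} → (Fin p → Fin p → Maybe (LabelSet k)) → Tree
encodeTemplate = encodeMatrix (encodeMaybe encodeLabelSet)

true-free : ∀ {k p} (t : Fin p → Fin p → Maybe (LabelSet k)) a b →
            IsTrue (value freePR (encodeTemplate t ∷ encodeItem a ∷ encodeItem b ∷ [])) ⇔ FreeItems t a b
true-free t (x , ℓ) (y , ℓ′)
  rewrite value-nth-tabulate (λ i → encodeList (List.tabulate λ j → encodeMaybe encodeLabelSet (t i j))) x
        | value-nth-tabulate (λ j → encodeMaybe encodeLabelSet (t x j)) y
  with t x y
... | nothing = mk⇔ (λ _ → tt) (λ _ → tt)
... | just (a , b) rewrite value-nth-subset a ℓ | value-nth-subset b ℓ′
  with Vec.lookup a ℓ | Vec.lookup b ℓ′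
... | false | false = mk⇔ (λ _ → (λ ()) , (λ ())) (λ _ → tt)
... | false | true  = mk⇔ (λ ()) (λ (_ , h) → h tt)
... | true  | _     = mk⇔ (λ ()) (λ (h , _) → h tt)

caseTree-dec : ∀ {X P : Set} t {n c : X} → IsTrue t ⇔ P → (d : Dec P) →
               caseTree t n (λ _ _ → c) ≡ (if does d then c else n)
caseTree-dec nil     h (yes p) = ⊥-elim (from h p)
caseTree-dec nil     h (no _)  = refl
caseTree-dec (_ ∙ _) h (yes _) = refl
caseTree-dec (_ ∙ _) h (no ¬p) = ⊥-elim (¬p (to h tt))

true-eqFin : ∀ {k} (a b : Fin k) → IsTrue (treeEq (encodeFin a) (encodeFin b)) ⇔ a ≡ b
true-eqFin a b = mk⇔ (encodeFin-injective ∘ to (true-treeEq _ _)) (from (true-treeEq _ _) ∘ cong encodeFin)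

projectPR : PR 2
projectPR = fold nil (case (eq (comp fstPR (var 1F ∷ [])) (var 4F))
                       (var 0F) (comp sndPR (var 3F ∷ []) ∙ var 2F)) (var 1F)

value-project : ∀ {p k} (x : Fin p) (τ : List (Fin p × Fin k)) →
                value projectPR (encodeFin x ∷ encodeWord encodeItem τ ∷ []) ≡ encodeWord encodeFin (proj x τ)
value-project {p} {k} x τ = go τ
  where
  go : ∀ σ → foldTree nil (λ r i _ → caseTree (treeEq (value fstPR (i ∷ [])) (encodeFin x)) r
                                      (λ _ _ → value sndPR (i ∷ []) ∙ r)) (encodeWord encodeItem σ)
             ≡ encodeWord encodeFin (proj {Y = Fin k} x σ)
  go []            = refl
  go ((y , ℓ) ∷ σ) with x Fin.≟ y in e
  ... | yes refl = trans (caseTree-dec _ (true-eqFin y x) (yes refl)) (cong (encodeFin ℓ ∙_) (go σ))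
  ... | no  x≢y  = trans (caseTree-dec _ (true-eqFin y x) (no (x≢y ∘ sym))) (go σ)

memberPR : PR 2
memberPR = anyPR (eq (var 1F) (var 0F)) (var 1F)

true-member : ∀ a t → IsTrue (value memberPR (a ∷ t ∷ [])) ⇔ a ∈ spine t
true-member a t = mk⇔ (Any.map (to (true-treeEq a _)) ∘ to any) (from any ∘ Any.map (from (true-treeEq a _)))
  where any = true-anyPR (eq (var 1F) (var 0F)) (var 1F) (a ∷ t ∷ [])

deletePR : PR 2
deletePR = fold nil (case (andPR (eq (var 1F) (var 4F)) (comp memberPR (var 4F ∷ var 2F ∷ [])))
                      -- In the branch for a match `case` has pushed two variables, so `var 4F` is
                      -- the tail of the word.
                      (var 1F ∙ var 0F) (var 4F)) (var 1F)

reducePR : PR 1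
reducePR = fold nil (var 1F ∙ comp deletePR (var 1F ∷ var 0F ∷ [])) (var 0F)

module _ {k : ℕ} where
  open Occurrences (Fin._≟_ {k})
  open DecMembership (Fin._≟_ {k}) using (_∈?_)

  encode : List (Fin k) → Tree
  encode = encodeWord encodeFin

  true-memberFin : ∀ a w → IsTrue (value memberPR (encodeFin a ∷ encode w ∷ [])) ⇔ a ∈ w
  true-memberFin a w = mk⇔
    (λ h → decode (∈-map⁻ encodeFin (subst (_ ∈_) (spine-encodeList _) (to (true-member _ _) h))))
    (λ m → from (true-member _ _) (subst (_ ∈_) (sym (spine-encodeList _)) (∈-map⁺ encodeFin m)))
    where
    decode : ∃[ b ] b ∈ w × encodeFin a ≡ encodeFin b → a ∈ w
    decode (b , m , e) = subst (_∈ w) (sym (encodeFin-injective e)) m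

  value-delete : ∀ a w → value deletePR (encodeFin a ∷ encode w ∷ []) ≡ encode (delete a w)
  value-delete a w = go w
    where
    step : Tree → Tree → Tree → Tree
    step r b y = value (case (andPR (eq (var 1F) (var 4F)) (comp memberPR (var 4F ∷ var 2F ∷ [])))
                          (var 1F ∙ var 0F) (var 4F)) (r ∷ b ∷ y ∷ (b ∙ y) ∷ encodeFin a ∷ encode w ∷ [])
    go : ∀ v → foldTree nil step (encode v) ≡ encode (delete a v)
    go []      = refl
    go (b ∷ v) = trans (caseTree-dec _ condition (b Fin.≟ a ×-dec a ∈? v)) cases
      where
      r : Tree
      r = foldTree nil step (encode v)
      both = true-andPR (eq (var 1F) (var 4F)) (comp memberPR (var 4F ∷ var 2F ∷ []))
               (r ∷ encodeFin b ∷ encode v ∷ encode (b ∷ v) ∷ encodeFin a ∷ encode w ∷ [])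
      condition : IsTrue (value (andPR (eq (var 1F) (var 4F)) (comp memberPR (var 4F ∷ var 2F ∷ [])))
                    (r ∷ encodeFin b ∷ encode v ∷ encode (b ∷ v) ∷ encodeFin a ∷ encode w ∷ [])) ⇔
                  (b ≡ a × a ∈ v)
      condition = mk⇔ (λ h → let p , q = to both h in to (true-eqFin b a) p , to (true-memberFin a v) q)
                      (λ (p , q) → from both (from (true-eqFin b a) p , from (true-memberFin a v) q))
      cases : (if does (b Fin.≟ a) ∧ does (a ∈? v) then encode v else encodeFin b ∙ r) ≡
              encode (if does (b Fin.≟ a) ∧ does (a ∈? v) then v else b ∷ delete a v)
      cases with does (b Fin.≟ a) ∧ does (a ∈? v)
      ... | true  = refl
      ... | false = cong (encodeFin b ∙_) (go v)

  value-reduce : ∀ w → value reducePR (encode w ∷ []) ≡ encode (reduce w)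
  value-reduce []      = refl
  value-reduce (a ∷ w) = cong (encodeFin a ∙_)
    (trans (cong (λ t → value deletePR (encodeFin a ∷ t ∷ [])) (value-reduce w)) (value-delete a (reduce w)))

labelsPR : PR 1
labelsPR = mapPR (comp sndPR (var 0F ∷ [])) (var 0F)

value-labels : ∀ {p k} (τ : List (Fin p × Fin k)) →
               value labelsPR (encodeWord encodeItem τ ∷ []) ≡ encode (List.map proj₂ τ)
value-labels []            = refl
value-labels ((_ , ℓ) ∷ τ) = cong (encodeFin ℓ ∙_) (value-labels τ)

-- In the terms below k, p, the template and the list of the operands'
-- summaries stand at the end of the environment.
validPR projectionsPR labelingPR checkPR : PR 6
validPR       = pairwisePR (comp freePR (var 6F ∷ var 0F ∷ var 1F ∷ [])) (var 0F)
projectionsPR = allPR (comp memberPR (comp projectPR (var 0F ∷ var 1F ∷ []) ∷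
                                      comp nthPR (var 0F ∷ var 6F ∷ []) ∷ []))
                      (comp rangePR (var 3F ∷ []))
labelingPR    = eq (comp reducePR (comp labelsPR (var 0F ∷ []) ∷ [])) (var 1F)
checkPR       = andPR validPR (andPR projectionsPR labelingPR)

taggedWordsPR : PR 5
taggedWordsPR = comp wordsPR (comp alphabetPR (var 2F ∷ var 1F ∷ []) ∷
                              comp timesPR (var 2F ∷ comp append (var 1F ∷ var 1F ∷ []) ∷ []) ∷ [])

shortWordsPR : PR 1
shortWordsPR = comp wordsPR (comp rangePR (var 0F ∷ []) ∷ comp append (var 0F ∷ var 0F ∷ []) ∷ [])

-- A node filters the short label words by a search over the tagged words. Collecting the results of
-- that search instead would list words once per witness; filtering keeps the summary inside a list
-- that depends on k only.
nodePR vertexPR : PR 4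
nodePR   = filterPR (anyPR checkPR taggedWordsPR) (comp shortWordsPR (var 0F ∷ []))
vertexPR = mapPR (var 0F ∙ nil) (comp rangePR (var 0F ∷ []))

∈-vertex : ∀ k {a b c} v → v ∈ spine (value vertexPR (encodeℕ k ∷ a ∷ b ∷ c ∷ [])) ⇔
           (∃[ ℓ ] v ≡ encode {k} (ℓ ∷ []))
∈-vertex k {a} {b} {c} v = mk⇔ sound (λ (ℓ , e) → from map∈ (_ , from (lists-range k _) (ℓ , refl) , e))
  where
  map∈ : ∀ {v} → v ∈ spine (value vertexPR (encodeℕ k ∷ a ∷ b ∷ c ∷ [])) ⇔ _
  map∈ = ∈-mapPR (var 0F ∙ nil) (comp rangePR (var 0F ∷ [])) (encodeℕ k ∷ a ∷ b ∷ c ∷ [])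
  sound : v ∈ spine (value vertexPR (encodeℕ k ∷ a ∷ b ∷ c ∷ [])) → ∃[ ℓ ] v ≡ encode {k} (ℓ ∷ [])
  sound m with x , x∈ , refl ← to map∈ m with ℓ , refl ← to (lists-range k x) x∈ = ℓ , refl

module _ {k p} (t : Fin p → Fin p → Maybe (LabelSet k)) (S : Fin p → Tree) where
  open Occurrences (Fin._≟_ {k}) using (reduce)

  private
    ρ : Vec Tree 4
    ρ = encodeℕ k ∷ encodeℕ p ∷ encodeTemplate t ∷ encodeList (List.tabulate S) ∷ []

  Combines : List (Fin p × Fin k) → List (Fin k) → Set
  Combines τ s = AllPairs (FreeItems t) τ × (∀ x → encode (proj x τ) ∈ spine (S x)) ×
                 reduce (List.map proj₂ τ) ≡ s

  true-check : ∀ τ s → IsTrue (value checkPR (encodeWord encodeItem τ ∷ encode s ∷ ρ)) ⇔ Combines τ s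
  true-check τ s = mk⇔
    (λ h → let a , bc = to and₁ h ; b , c = to and₂ bc in
      to valid a , to projections b , to labeling c)
    (λ (a , b , c) → from and₁ (from valid a , from and₂ (from projections b , from labeling c)))
    where
    σ : Vec Tree 6
    σ = encodeWord encodeItem τ ∷ encode s ∷ ρ
    and₁ = true-andPR validPR (andPR projectionsPR labelingPR) σ
    and₂ = true-andPR projectionsPR labelingPR σ
    valid : IsTrue (value validPR σ) ⇔ AllPairs (FreeItems t) τ
    valid = mk⇔
      (λ h → AllPairs.map (λ {a} {b} → to (true-free t a b)) (AllPairsP.map⁻
        (subst (AllPairs _) (spine-encodeList (List.map encodeItem τ)) (to pairs h))))
      (λ h → from pairs (subst (AllPairs _) (sym (spine-encodeList (List.map encodeItem τ)))
        (AllPairsP.map⁺ (AllPairs.map (λ {a} {b} → from (true-free t a b)) h))))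
      where pairs = true-pairwisePR (comp freePR (var 6F ∷ var 0F ∷ var 1F ∷ [])) (var 0F) σ
    projections : IsTrue (value projectionsPR σ) ⇔ (∀ x → encode (proj x τ) ∈ spine (S x))
    projections = mk⇔
      (λ h x → to (single x) (All.lookup (to every h) (from (lists-range p _) (x , refl))))
      (λ h → from every (All.tabulate λ m → each h (to (lists-range p _) m)))
      where
      memberOf : PR 7
      memberOf = comp memberPR (comp projectPR (var 0F ∷ var 1F ∷ []) ∷
                                comp nthPR (var 0F ∷ var 6F ∷ []) ∷ [])
      every = true-allPR memberOf (comp rangePR (var 3F ∷ [])) σ
      single : ∀ x → IsTrue (value memberOf (encodeFin x ∷ σ)) ⇔ encode (proj x τ) ∈ spine (S x)
      single x rewrite value-project x τ | value-nth-tabulate S x = true-member _ (S x)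
      each : (∀ x → encode (proj x τ) ∈ spine (S x)) → ∀ {v} → ∃[ x ] v ≡ encodeFin x →
             IsTrue (value memberOf (v ∷ σ))
      each h (x , refl) = from (single x) (h x)
    labeling : IsTrue (value labelingPR σ) ⇔ reduce (List.map proj₂ τ) ≡ s
    labeling rewrite value-labels τ | value-reduce (List.map proj₂ τ) = mk⇔
      (encodeWord-injective encodeFin-injective ∘ to (true-treeEq _ _))
      (from (true-treeEq _ _) ∘ cong encode)

  ∈-node : ∀ v → v ∈ spine (value nodePR ρ) ⇔
           (∃[ s ] length s ≤ k + k × v ≡ encode s × ∃[ τ ] length τ ≤ p * (k + k) × Combines τ s)
  ∈-node v = mk⇔ sound complete
    where
    tagged : ∀ {a} u → u ∈ spine (value taggedWordsPR (a ∷ ρ)) ⇔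
             (∃[ τ ] length τ ≤ p * (k + k) × u ≡ encodeWord encodeItem τ)
    tagged u rewrite append-encodeℕ k k | value-times p (k + k) = ∈-words (lists-alphabet p k) (p * (k + k)) u
    short : ∀ u → u ∈ spine (value shortWordsPR (encodeℕ k ∷ [])) ⇔ (∃[ s ] length s ≤ k + k × u ≡ encode s)
    short u rewrite append-encodeℕ k k = ∈-words (lists-range k) (k + k) u
    selected : ∀ {u} → u ∈ spine (value nodePR ρ) ⇔ _
    selected = ∈-filterPR (anyPR checkPR taggedWordsPR) (comp shortWordsPR (var 0F ∷ [])) ρ
    some : ∀ {u} → IsTrue (value (anyPR checkPR taggedWordsPR) (u ∷ ρ)) ⇔ _
    some {u} = true-anyPR checkPR taggedWordsPR (u ∷ ρ)
    sound : v ∈ spine (value nodePR ρ) → _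
    sound m
      with v∈ , h ← to selected m
      with s , l , refl ← to (short v) v∈
      with u , u∈ , c ← find (to some h)
      with τ , l′ , refl ← to (tagged {encode s} u) u∈
      = s , l , refl , τ , l′ , to (true-check τ s) c
    complete : _ → v ∈ spine (value nodePR ρ)
    complete (s , l , refl , τ , l′ , c) = from selected
      (from (short _) (s , l , refl) ,
       from some (lose (from (tagged {encode s} _) (τ , l′ , refl)) (from (true-check τ s) c)))

-- Summaries of expressions

node : ∀ {k p} → (Fin p → Fin p → Maybe (LabelSet k)) → (Fin p → Tree) → Tree
node {k} {p} t S =
  value nodePR (encodeℕ k ∷ encodeℕ p ∷ encodeTemplate t ∷ encodeList (List.tabulate S) ∷ [])

summary : ∀ {k} → Expr k → Tree
summary {k} vertex             = value vertexPR (encodeℕ k ∷ nil ∷ nil ∷ nil ∷ [])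
summary {k} (union e₁ e₂)      = node {k} (template₂ nothing nothing) (pair (summary e₁) (summary e₂))
summary {k} (join L e₁ e₂)     = node {k} (template₂ (fromThis L) (fromThat L)) (pair (summary e₁) (summary e₂))
summary {k} (substitute _ t _ es) = node {k} t (summary ∘ es)

-- The invariant of the dynamic program. `sound` allows a listed word to be expanded to a realised
-- one, `complete` allows a realised word to be contracted to a listed one; the length bound in
-- `complete` keeps the search at the enclosing node exhaustive.
record Summarizes {k} (W : List (Fin k) → Set) (S : Tree) : Set where
  field
    sound    : ∀ v → v ∈ spine S → ∃[ s ] v ≡ encode s × ∃[ w ] W w × w ⟶* s
    complete : ∀ w → W w → ∃[ s ] length s ≤ k + k × w ⟶* s × encode s ∈ spine S

open Summarizes

summarizes-⇔ : ∀ {k} {W W′ : List (Fin k) → Set} {S} → (∀ {w} → W w ⇔ W′ w) →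
               Summarizes W S → Summarizes W′ S
summarizes-⇔ h s = record
  { sound    = λ v m → let v′ , e , w , h′ , r = sound s v m in v′ , e , w , to h h′ , r
  ; complete = λ w h′ → complete s w (from h h′) }

length-by-occurrences : ∀ {p} c (w : List (Fin p)) →
  (∀ x → Occurrences.occ Fin._≟_ x w ≤ c) → length w ≤ p * c
length-by-occurrences {p} c w h = subst (λ m → length w ≤ m * c) (length-tabulate {n = p} id)
  (Occurrences.length-bounded Fin._≟_ (allFin p) c w (All.tabulate λ {x} _ → ∈-allFin x) h)

module _ {k p} (2≤p : 2 ≤ p) (t : Fin p → Fin p → Maybe (LabelSet k))
         (loopless : ∀ x → t x x ≡ nothing) (es : Fin p → Expr k) (S : Fin p → Tree)
         (summarize : ∀ x → Summarizes (HasWord ⟦ es x ⟧) (S x)) where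
  open Occurrences (Fin._≟_ {k})

  length-reduce : ∀ w → length (reduce w) ≤ k + k
  length-reduce w = ≤-trans (length-by-occurrences 2 (reduce w) (λ x → occ-reduce x w))
    (≤-reflexive (trans (*-comm k 2) (cong (k +_) (+-identityʳ k))))

  private
    operand-word : ∀ {w} x → encode w ∈ spine (S x) → ∃[ v ] HasWord ⟦ es x ⟧ v × v ⟶* w
    operand-word x m with s , e , v , h , r ← sound (summarize x) _ m =
      v , h , subst (v ⟶*_) (sym (encodeWord-injective encodeFin-injective e)) r

  -- For `sound`, the projections of the τ found are expanded to realised operand words; the
  -- enlarged τ is still valid since deletions can be undone. For `complete`, the projections of a
  -- realised interleaving are contracted to listed words, which preserves validity and makes τ
  -- short enough to be searched.
  summarizes-node : Summarizes (HasWord ⟦ substitute 2≤p t loopless es ⟧) (node t S)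
  summarizes-node .sound v m
    with s , _ , refl , τ , _ , free , projections , refl ← to (∈-node t S v) m
    with τ′ , r , e ← expand-all τ (λ x → proj₁ (operand-word x (projections x)))
                                   (λ x → proj₂ (proj₂ (operand-word x (projections x))))
    = s , refl , List.map proj₂ τ′ ,
      substitute-join 2≤p t loopless es τ′ (AllPairs-⟵* r free)
        (λ x → subst (HasWord ⟦ es x ⟧) (sym (e x)) (proj₁ (proj₂ (operand-word x (projections x))))) ,
      (labels-⟶* r ◅◅ reduces (List.map proj₂ τ))
  summarizes-node .complete w h
    with τ , free , words , refl ← substitute-split 2≤p t loopless es h
    with τ′ , r , e ← contract-all τ (λ x → proj₁ (complete (summarize x) _ (words x)))
                        (λ x → proj₁ (proj₂ (proj₂ (complete (summarize x) _ (words x)))))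
    = reduce (List.map proj₂ τ′) , length-reduce (List.map proj₂ τ′) ,
      (labels-⟶* r ◅◅ reduces (List.map proj₂ τ′)) ,
      from (∈-node t S _) (_ , length-reduce (List.map proj₂ τ′) , refl , τ′ , bounded ,
        AllPairs-⟶* r free , projections , refl)
    where
    bounded : length τ′ ≤ p * (k + k)
    bounded = subst (_≤ p * (k + k)) (length-map proj₁ τ′)
      -- Operand x occurs in `τ′` as often as its projection is long, hence at most 2k times.
      (length-by-occurrences (k + k) (List.map proj₁ τ′) λ x →
        ≤-trans (≤-reflexive (trans (sym (length-proj x τ′)) (cong length (e x))))
                (proj₁ (proj₂ (complete (summarize x) _ (words x)))))
    projections : ∀ x → encode (proj x τ′) ∈ spine (S x)
    projections x = subst (λ v → encode v ∈ spine (S x)) (sym (e x))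
      (proj₂ (proj₂ (proj₂ (complete (summarize x) _ (words x)))))

summarizes-vertex : ∀ {k} → Summarizes (HasWord {k} ⟦ vertex ⟧) (summary {k} vertex)
summarizes-vertex {k} .sound v m with ℓ , refl ← to (∈-vertex k {nil} {nil} {nil} v) m =
  ℓ ∷ [] , refl , ℓ ∷ [] ,
  ((tt , ℓ) ∷ [] , ([] ∷ [] , λ _ → here refl) , refl) , ε
summarizes-vertex {k} .complete w ([] , (_ , covers) , _) with () ← covers tt
summarizes-vertex {k} .complete w ((_ , ℓ) ∷ [] , _ , refl) =
  -- The existence of a label gives 1 ≤ k, so a one-letter word meets the bound 2k.
  ℓ ∷ [] , nonzero ℓ , ε , from (∈-vertex k {nil} {nil} {nil} _) (ℓ , refl)
  where
  nonzero : ∀ {k} → Fin k → 1 ≤ k + k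
  nonzero zero    = s≤s z≤n
  nonzero (suc _) = s≤s z≤n
summarizes-vertex {k} .complete w (_ ∷ _ ∷ _ , ((p ∷ _) ∷ _ , _) , _) = ⊥-elim (proj₁ p refl)

summarizes-pair : ∀ {k} {e₁ e₂ : Expr k} {S₁ S₂} → Summarizes (HasWord ⟦ e₁ ⟧) S₁ →
                  Summarizes (HasWord ⟦ e₂ ⟧) S₂ →
                  ∀ x → Summarizes (HasWord ⟦ pair e₁ e₂ x ⟧) (pair S₁ S₂ x)
summarizes-pair h₁ h₂ 0F = h₁
summarizes-pair h₁ h₂ 1F = h₂

summarizes : ∀ {k} (e : Expr k) → Summarizes (HasWord ⟦ e ⟧) (summary e)
summarizes vertex = summarizes-vertex
summarizes (union e₁ e₂) = summarizes-⇔ (union-word e₁ e₂)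
  (summarizes-node ≤-refl _ (loopless₂ _ _) (pair e₁ e₂) _ (summarizes-pair (summarizes e₁) (summarizes e₂)))
summarizes (join L e₁ e₂) = summarizes-⇔ (join-word L e₁ e₂)
  (summarizes-node ≤-refl _ (loopless₂ _ _) (pair e₁ e₂) _ (summarizes-pair (summarizes e₁) (summarizes e₂)))
summarizes (substitute 2≤p t loopless es) =
  summarizes-node 2≤p t loopless es _ (λ x → summarizes (es x))

module _ {k n} (I : Instance k n) (D : Decomposition (labeledUnion I)) where
  open Decomposition D

  private
    words : ∀ {w} → HasWord ⟦ expr ⟧ w ⇔ HasWord (labeledUnion I) w
    words = relabel-⇔ vertices arcs-agree

  -- Read as a truth value, a list is true when it is nonempty; so the question is whether the
  -- expression realises any word at all.
  summary-correct : CompatibleOrdering I ⇔ IsTrue (summary expr)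
  summary-correct = mk⇔ forth back
    where
    forth : CompatibleOrdering I → IsTrue (summary expr)
    forth C with w , h ← ordering-word I C
      with s , _ , _ , m ← complete (summarizes expr) w (from words h) with summary expr | m
    ... | _ ∙ _ | _ = tt
    back : IsTrue (summary expr) → CompatibleOrdering I
    back h with summary expr in eq | h
    ... | v ∙ _ | _
      with _ , _ , w , h′ , _ ← sound (summarizes expr) v (subst (λ S → v ∈ spine S) (sym eq) (here refl))
      = word-ordering I (to words h′)

-- Sizes of the arguments of a node

size-encodeℕ : ∀ n → size (encodeℕ n) ≡ n
size-encodeℕ zero    = refl
size-encodeℕ (suc n) = cong suc (size-encodeℕ n)

size-tabulate : ∀ {p c} (f : Fin p → Tree) → (∀ x → size (f x) ≤ c) →
                size (encodeList (List.tabulate f)) ≤ p * suc c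
size-tabulate {zero}  f h = z≤n
size-tabulate {suc p} f h = s≤s (+-mono-≤ (h zero) (size-tabulate (f ∘ suc) (h ∘ suc)))

size-encodeSubset : ∀ {k} (a : Vec Bool k) → size (encodeSubset a) ≤ k * 2
size-encodeSubset []          = z≤n
size-encodeSubset (false ∷ a) = s≤s (m≤n⇒m≤1+n (size-encodeSubset a))
size-encodeSubset (true ∷ a)  = s≤s (s≤s (size-encodeSubset a))

size-entry : ∀ {k} (L : Maybe (LabelSet k)) →
             size (encodeMaybe encodeLabelSet L) ≤ 2 + (k * 2 + k * 2)
size-entry nothing        = z≤n
size-entry (just (a , b)) = s≤s (s≤s (+-mono-≤ (size-encodeSubset a) (size-encodeSubset b)))

size-encodeTemplate : ∀ {k p} (t : Fin p → Fin p → Maybe (LabelSet k)) →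
                      size (encodeTemplate t) ≤ p * suc (p * suc (2 + (k * 2 + k * 2)))
size-encodeTemplate t = size-tabulate _ λ x → size-tabulate _ λ y → size-entry (t x y)

-- At m = k + w the number q = m + 2 bounds k and every operand count; the 2 covers the templates of
-- union and join, which the width does not count. The three summands of `inputB` bound the
-- numerals, the template and the list of operand summaries.
summaryB inputB : Bound
summaryB = bound shortWordsPR +B bound vertexPR
inputB   = q +B q *B (constB 1 +B q *B (constB 3 +B (q *B constB 2 +B q *B constB 2)))
             +B q *B (constB 1 +B summaryB ∘B q)
  where q = idB +B constB 2

-- Opaque because conversion would otherwise normalise the bounds of large
-- closed terms.
opaque
  callB : Bound
  callB = (bound nodePR +B bound vertexPR) ∘B inputB

  node≤call : ∀ n → at (bound nodePR) (at inputB n) ≤ at callB n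
  node≤call n = m≤m+n _ _

  vertex≤call : ∀ n → at (bound vertexPR) (at inputB n) ≤ at callB n
  vertex≤call n = m≤n+m _ (at (bound nodePR) (at inputB n))

timeB : Bound
timeB = (callB +B constB 100) +B (callB +B constB 100)

-- The filter keeps part of the list of all words of length at most 2k, whatever the operands are;
-- hence sizes do not grow along the decomposition.
size-node : ∀ {k p} (t : Fin p → Fin p → Maybe (LabelSet k)) S → size (node t S) ≤ at summaryB k
size-node {k} {p} t S = ≤-trans
  (size-filterPR (anyPR checkPR taggedWordsPR) (comp shortWordsPR (var 0F ∷ []))
    (encodeℕ k ∷ encodeℕ p ∷ encodeTemplate t ∷ encodeList (List.tabulate S) ∷ []))
  (≤-trans (size-value shortWordsPR (≤-reflexive (size-encodeℕ k) ∷ []))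
  (m≤m+n (at (bound shortWordsPR) k) (at (bound vertexPR) k)))

size-summary : ∀ {k} (e : Expr k) → size (summary e) ≤ at summaryB k
size-summary {k} vertex =
  ≤-trans (size-value vertexPR (≤-reflexive (size-encodeℕ k) ∷ z≤n ∷ z≤n ∷ z≤n ∷ []))
    (m≤n+m (at (bound vertexPR) k) (at (bound shortWordsPR) k))
size-summary {k} (union e₁ e₂) =
  size-node {k} (template₂ nothing nothing) (pair (summary e₁) (summary e₂))
size-summary (join L e₁ e₂) =
  size-node (template₂ (fromThis L) (fromThat L)) (pair (summary e₁) (summary e₂))
size-summary (substitute _ t _ es) = size-node t (summary ∘ es)

module _ {k m : ℕ} (k≤m : k ≤ m) where

  private
    k≤q : k ≤ m + 2
    k≤q = ≤-trans k≤m (m≤m+n m 2)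

    q≤input : m + 2 ≤ at inputB m
    q≤input = m≤m+n (m + 2) _

  size-arguments : ∀ {p} (t : Fin p → Fin p → Maybe (LabelSet k)) (S : Fin p → Tree) →
                   p ≤ m + 2 → (∀ x → size (S x) ≤ at summaryB k) →
                   VecAll.All (λ v → size v ≤ at inputB m)
                     (encodeℕ k ∷ encodeℕ p ∷ encodeTemplate t ∷ encodeList (List.tabulate S) ∷ [])
  size-arguments {p} t S p≤q h =
    ≤-trans (≤-reflexive (size-encodeℕ k)) (≤-trans k≤q q≤input) ∷
    ≤-trans (≤-reflexive (size-encodeℕ p)) (≤-trans p≤q q≤input) ∷
    ≤-trans (≤-trans (size-encodeTemplate t)
      (*-mono-≤ p≤q (s≤s (*-mono-≤ p≤q (+-monoʳ-≤ 3 (+-mono-≤ (*-monoˡ-≤ 2 k≤q) (*-monoˡ-≤ 2 k≤q)))))))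
      (≤-trans (m≤m+n _ _) (m≤n+m _ (m + 2))) ∷
    ≤-trans (≤-trans (size-tabulate S h) (*-mono-≤ p≤q (s≤s (mono summaryB k≤q))))
      (≤-trans (m≤n+m _ _) (m≤n+m _ (m + 2))) ∷
    []

  size-vertex-arguments : VecAll.All (λ v → size v ≤ at inputB m) (encodeℕ k ∷ nil ∷ nil ∷ nil ∷ [])
  size-vertex-arguments =
    ≤-trans (≤-reflexive (size-encodeℕ k)) (≤-trans k≤q q≤input) ∷ z≤n ∷ z≤n ∷ z≤n ∷ []

-- Counting leaves

total : ∀ {p} → (Fin p → ℕ) → ℕ
total {zero}  f = 0
total {suc p} f = f zero + total (f ∘ suc)

leaves : ∀ {k} → Expr k → ℕ
leaves vertex                = 1
leaves (union e₁ e₂)         = leaves e₁ + leaves e₂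
leaves (join _ e₁ e₂)        = leaves e₁ + leaves e₂
leaves (substitute _ _ _ es) = total (leaves ∘ es)

Σ-suc : ∀ {p} (W : Fin (suc p) → Set) → (W zero ⊎ Σ (Fin p) (W ∘ suc)) ↔ Σ (Fin (suc p)) W
Σ-suc W = mk↔ₛ′ (λ { (inj₁ u) → zero , u ; (inj₂ (x , u)) → suc x , u })
                (λ { (zero , u) → inj₁ u ; (suc x , u) → inj₂ (x , u) })
                (λ { (zero , u) → refl ; (suc x , u) → refl })
                (λ { (inj₁ u) → refl ; (inj₂ (x , u)) → refl })

Σ-total : ∀ {p} {W : Fin p → Set} (f : Fin p → ℕ) → (∀ x → Fin (f x) ↔ W x) → Fin (total f) ↔ Σ (Fin p) W
Σ-total {zero}  f h = mk↔ₛ′ (λ ()) (λ ()) (λ ()) (λ ())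
Σ-total {suc p} f h = ↔-trans +↔⊎ (↔-trans (h zero ⊎-↔ Σ-total (f ∘ suc) (h ∘ suc)) (Σ-suc _))

-- Combined with the bijection of a decomposition, this equates the number of leaves with n and
-- turns a cost per leaf into a bound in the number of vertices.
leaves-vertices : ∀ {k} (e : Expr k) → Fin (leaves e) ↔ Vertex e
leaves-vertices vertex                = 1↔⊤
leaves-vertices (union e₁ e₂)         = ↔-trans +↔⊎ (leaves-vertices e₁ ⊎-↔ leaves-vertices e₂)
leaves-vertices (join _ e₁ e₂)        = ↔-trans +↔⊎ (leaves-vertices e₁ ⊎-↔ leaves-vertices e₂)
leaves-vertices (substitute _ _ _ es) = Σ-total (leaves ∘ es) (leaves-vertices ∘ es)

-- The recursion over expressions and its cost

module Solver {m} (arity : Fin m → ℕ) (equal solve solveList : Func arity 2)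
              (vertexF nodeF : Func arity 4) where
  open Compile arity equal using (invoke)

  -- The environment is k, e with e the encoding of an expression (solve) or
  -- of a list of expressions (solveList), preceded by two variables for each
  -- enclosing case.  The nested cases on the tag lead to vertex, union, join
  -- and substitute, in this order.
  solveBody : Term arity 2
  solveBody =
    case (var 1F) nil
      (case (var 0F)
        (invoke vertexF (var 2F ∷ nil ∷ nil ∷ nil ∷ []))
        (case (var 3F) nil
          (case (var 3F)
            (invoke nodeF (var 6F ∷ (nil ∙ nil ∙ nil) ∷
              ((nil ∙ nil ∙ nil) ∙ (nil ∙ nil ∙ nil) ∙ nil) ∷
              (invoke solve (var 6F ∷ var 0F ∷ []) ∙ invoke solve (var 6F ∷ var 1F ∷ []) ∙ nil) ∷ []))
            (case (var 3F) nil
              (case (var 3F)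
                (case (var 4F) nil
                  (invoke nodeF (var (# 12) ∷ (nil ∙ nil ∙ nil) ∷
                    ((nil ∙ var 0F ∙ nil) ∙ (var 1F ∙ nil ∙ nil) ∙ nil) ∷
                    (invoke solve (var (# 12) ∷ var 2F ∷ []) ∙ invoke solve (var (# 12) ∷ var 3F ∷ []) ∙ nil) ∷ [])))
                (invoke nodeF (var (# 12) ∷ var 6F ∷ var 2F ∷
                  invoke solveList (var (# 12) ∷ var 3F ∷ []) ∷ [])))))))

  solveListBody : Term arity 2
  solveListBody = case (var 1F) nil
    (invoke solve (var 2F ∷ var 0F ∷ []) ∙ invoke solveList (var 2F ∷ var 1F ∷ []))

  mainBody : Term arity 1
  mainBody = case (var 0F) nil (case (var 0F) nil
    (case (invoke solve (var 0F ∷ var 3F ∷ [])) nil (nil ∙ nil)))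

module SolverCost (P : Program) (equal solve solveList : Func (Program.arity P) 2)
                  (vertexF nodeF : Func (Program.arity P) 4) where
  open Program P using (arity)
  open Evaluation P equal
  open Solver arity equal solve solveList vertexF nodeF
  open Compile arity equal using (invoke)

  module _ (solve-linked : bodyOf solve ≡ solveBody) (solveList-linked : bodyOf solveList ≡ solveListBody)
           {k w F : ℕ}
           (vertex-⇓ : ∃[ c ] (encodeℕ k ∷ nil ∷ nil ∷ nil ∷ [] ⊢ bodyOf vertexF ⇓ summary {k} vertex cost c) × c ≤ F)
           (node-⇓ : ∀ {p} (t : Fin p → Fin p → Maybe (LabelSet k)) S →
              p ≤ k + w + 2 → (∀ x → size (S x) ≤ at summaryB k) →
              ∃[ c ] (encodeℕ k ∷ encodeℕ p ∷ encodeTemplate t ∷ encodeList (List.tabulate S) ∷ []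
                        ⊢ bodyOf nodeF ⇓ node t S cost c) × c ≤ F)
           where

    private
      Q : ℕ
      Q = F + 100

      -- An expression has at most 2 · leaves − 1 nodes, and Q bounds the cost
      -- per node: F for the call of nodeF or vertexF, and 100 exceeds the
      -- overhead of every branch of solveBody.
      Solved : (e : Expr k) → (Vertex e → ℕ) → Set
      Solved e name = ∃[ c ] (encodeℕ k ∷ encodeExpr e name ∷ [] ⊢ solveBody ⇓ summary e cost c) ×
                             c + Q ≤ leaves e * (Q + Q)

      call-solve : ∀ {j} {ρ : Vec Tree j} {a b x v c} → Vec.lookup ρ a ≡ encodeℕ k → Vec.lookup ρ b ≡ x →
                   encodeℕ k ∷ x ∷ [] ⊢ solveBody ⇓ v cost c →
                   ρ ⊢ invoke solve (var a ∷ var b ∷ []) ⇓ v cost (3 + c)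
      call-solve {ρ = ρ} {a} {b} p q d = invoke-⇓ solve
        (subst₂ (λ x y → ρ ⊢* var a ∷ var b ∷ [] ⇓ x ∷ y ∷ [] cost 2) p q (var a ∷ (var b ∷ [])))
        (subst (λ b → _ ⊢ b ⇓ _ cost _) (sym solve-linked) d)

      call-solveList : ∀ {j} {ρ : Vec Tree j} {a b x v c} → Vec.lookup ρ a ≡ encodeℕ k → Vec.lookup ρ b ≡ x →
                   encodeℕ k ∷ x ∷ [] ⊢ solveListBody ⇓ v cost c →
                   ρ ⊢ invoke solveList (var a ∷ var b ∷ []) ⇓ v cost (3 + c)
      call-solveList {ρ = ρ} {a} {b} p q d = invoke-⇓ solveList
        (subst₂ (λ x y → ρ ⊢* var a ∷ var b ∷ [] ⇓ x ∷ y ∷ [] cost 2) p q (var a ∷ (var b ∷ [])))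
        (subst (λ b → _ ⊢ b ⇓ _ cost _) (sym solveList-linked) d)

      -- Each operand brings a spare `Q`: one is passed on as the spare of the parent, the other
      -- pays for the call at the node and its overhead.
      solved-pair : ∀ i {c c₁ c₂ l₁ l₂} → 5 + i ≤ 100 → c ≤ F →
                    c₁ + Q ≤ l₁ * (Q + Q) → c₂ + Q ≤ l₂ * (Q + Q) →
                    i + (c₁ + suc (3 + c₂ + 1) + 0 + c) + Q ≤ (l₁ + l₂) * (Q + Q)
      solved-pair i {c} {c₁} {c₂} {l₁} {l₂} i≤ c≤ p₁ p₂ = begin
        i + (c₁ + suc (3 + c₂ + 1) + 0 + c) + Q ≡⟨ arrange i c c₁ c₂ Q ⟩
        (c₁ + Q) + (c₂ + (c + (5 + i)))  ≤⟨ +-mono-≤ p₁ (≤-trans (+-monoʳ-≤ c₂ (+-mono-≤ c≤ i≤)) p₂) ⟩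
        l₁ * (Q + Q) + l₂ * (Q + Q) ≡⟨ *-distribʳ-+ (Q + Q) l₁ l₂ ⟨
        (l₁ + l₂) * (Q + Q)        ∎
        where
        open ≤-Reasoning
        arrange : ∀ i c c₁ c₂ Q → i + (c₁ + suc (3 + c₂ + 1) + 0 + c) + Q ≡ (c₁ + Q) + (c₂ + (c + (5 + i)))
        arrange = solve-∀

      size-pair : ∀ (e₁ e₂ : Expr k) x → size (pair (summary e₁) (summary e₂) x) ≤ at summaryB k
      size-pair e₁ e₂ 0F = size-summary e₁
      size-pair e₁ e₂ 1F = size-summary e₂

    solve-vertex : ∀ name → Solved vertex name
    solve-vertex name = let c , d , p = vertex-⇓ in
      9 + c ,
      case-cons (var _) (case-nil (var _) (invoke-⇓ vertexF (var _ ∷ (nil ∷ (nil ∷ (nil ∷ [])))) d)) ,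
      ≤-trans (+-monoˡ-≤ Q (≤-trans (+-mono-≤ (m≤m+n 9 91) p) (≤-reflexive (+-comm 100 F))))
              (≤-reflexive (sym (*-identityˡ (Q + Q))))

    solve-union : ∀ e₁ e₂ name → Solved e₁ (name ∘ inj₁) → Solved e₂ (name ∘ inj₂) → Solved (union e₁ e₂) name
    solve-union e₁ e₂ name (c₁ , d₁ , p₁) (c₂ , d₂ , p₂)
      with c , d , p ← node-⇓ (template₂ nothing nothing) (pair (summary e₁) (summary e₂))
                         (m≤n+m 2 _) (size-pair e₁ e₂) =
        _ , case-cons (var _) (case-cons (var _) (case-cons (var _) (case-nil (var _)
              (invoke-⇓ nodeF (var _ ∷ ((nil ∙ (nil ∙ nil)) ∷
                (((nil ∙ (nil ∙ nil)) ∙ ((nil ∙ (nil ∙ nil)) ∙ nil)) ∷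
                ((call-solve {a = 6F} {0F} refl refl d₁ ∙ (call-solve {a = 6F} {1F} refl refl d₂ ∙ nil)) ∷ [])))) d)))) ,
        solved-pair 32 {c₁ = c₁} {c₂} {leaves e₁} {leaves e₂} (m≤m+n 37 63) p p₁ p₂

    solve-join : ∀ L e₁ e₂ name → Solved e₁ (name ∘ inj₁) → Solved e₂ (name ∘ inj₂) → Solved (join L e₁ e₂) name
    solve-join L e₁ e₂ name (c₁ , d₁ , p₁) (c₂ , d₂ , p₂)
      with c , d , p ← node-⇓ (template₂ (fromThis L) (fromThat L)) (pair (summary e₁) (summary e₂))
                         (m≤n+m 2 _) (size-pair e₁ e₂) =
        _ , case-cons (var _) (case-cons (var _) (case-cons (var _) (case-cons (var _) (case-cons (var _)
              (case-nil (var _) (case-cons (var _)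
              (invoke-⇓ nodeF (var _ ∷ ((nil ∙ (nil ∙ nil)) ∷
                (((nil ∙ (var _ ∙ nil)) ∙ ((var _ ∙ (nil ∙ nil)) ∙ nil)) ∷
                ((call-solve {a = # 12} {2F} refl refl d₁ ∙ (call-solve {a = # 12} {3F} refl refl d₂ ∙ nil)) ∷ [])))) d))))))) ,
        solved-pair 38 {c₁ = c₁} {c₂} {leaves e₁} {leaves e₂} (m≤m+n 43 57) p p₁ p₂

    -- The spares of all operands are kept for the node above; a list cell costs 9 beyond its
    -- operand, and the end of the list costs 3.
    solve-list : ∀ {p} (es : Fin p → Expr k) (name : ∀ x → Vertex (es x) → ℕ) →
      (∀ x → Solved (es x) (name x)) →
      ∃[ c ] (encodeℕ k ∷ encodeList (List.tabulate λ x → encodeExpr (es x) (name x)) ∷ []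
                ⊢ solveListBody ⇓ encodeList (List.tabulate (summary ∘ es)) cost c) ×
             c + p * Q ≤ total (leaves ∘ es) * (Q + Q) + (p * 9 + 3)
    solve-list {zero}  es name h = _ , case-nil (var _) nil , ≤-refl
    solve-list {suc p} es name h
      with c₁ , d₁ , p₁ ← h zero
         | c₂ , d₂ , p₂ ← solve-list (es ∘ suc) (λ x → name (suc x)) (λ x → h (suc x)) =
      _ , case-cons (var _) (call-solve {a = 2F} {0F} refl refl d₁ ∙ call-solveList {a = 2F} {1F} refl refl d₂) ,
      (begin
        6 + (c₁ + (3 + c₂)) + (Q + p * Q)  ≡⟨ arrange₁ c₁ c₂ Q (p * Q) ⟩
        (c₁ + Q) + (c₂ + p * Q) + 9        ≤⟨ +-monoˡ-≤ 9 (+-mono-≤ p₁ p₂) ⟩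
        leaves (es zero) * (Q + Q) + (total (leaves ∘ es ∘ suc) * (Q + Q) + (p * 9 + 3)) + 9
          ≡⟨ arrange₂ (leaves (es zero)) (total (leaves ∘ es ∘ suc)) (Q + Q) (p * 9) ⟩
        (leaves (es zero) + total (leaves ∘ es ∘ suc)) * (Q + Q) + (9 + p * 9 + 3) ∎)
      where
      open ≤-Reasoning
      arrange₁ : ∀ c₁ c₂ Q P → 6 + (c₁ + (3 + c₂)) + (Q + P) ≡ (c₁ + Q) + (c₂ + P) + 9
      arrange₁ = solve-∀
      arrange₂ : ∀ a b R P → a * R + (b * R + (P + 3)) + 9 ≡ (a + b) * R + (9 + P + 3)
      arrange₂ = solve-∀

    -- Of the p spares one is passed on, and the remaining p - 1 pay for the call at the node and
    -- the traversal of the operand list. As p is at least 2, at least one is available to be spent.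
    substitute-cost : ∀ {p} → 2 ≤ p → ∀ {c c₁ l} → c ≤ F → c₁ + p * Q ≤ l * (Q + Q) + (p * 9 + 3) →
                      19 + (c₁ + 0 + c) + Q ≤ l * (Q + Q)
    substitute-cost (s≤s (s≤s (z≤n {r}))) {c} {c₁} {l} p p₁ = +-cancelʳ-≤ ((1 + r) * Q) _ _ (begin
      19 + (c₁ + 0 + c) + Q + (1 + r) * Q           ≡⟨ arrange₁ c₁ c Q (r * Q) ⟩
      (c₁ + (2 + r) * Q) + (c + 19)                 ≤⟨ +-mono-≤ p₁ (+-monoˡ-≤ 19 p) ⟩
      l * (Q + Q) + ((2 + r) * 9 + 3) + (F + 19)    ≤⟨ m≤m+n _ (60 + r * F + 91 * r) ⟩
      l * (Q + Q) + ((2 + r) * 9 + 3) + (F + 19) + (60 + r * F + 91 * r) ≡⟨ arrange₂ (l * (Q + Q)) F r ⟩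
      l * (Q + Q) + (1 + r) * Q                     ∎)
      where
      open ≤-Reasoning
      arrange₁ : ∀ c₁ c Q P → 19 + (c₁ + 0 + c) + Q + (Q + P) ≡ (c₁ + (Q + (Q + P))) + (c + 19)
      arrange₁ = solve-∀
      arrange₂ : ∀ a F r → a + ((2 + r) * 9 + 3) + (F + 19) + (60 + r * F + 91 * r) ≡
                           a + (1 + r) * (F + 100)
      arrange₂ = solve-∀

    solve-substitute : ∀ {p} (2≤p : 2 ≤ p) t loopless (es : Fin p → Expr k) name → p ≤ k + w + 2 →
                       (∀ x → Solved (es x) (λ u → name (x , u))) → Solved (substitute 2≤p t loopless es) name
    solve-substitute 2≤p t _ es name p≤ h
      with c₁ , d₁ , p₁ ← solve-list es (λ x u → name (x , u)) h
         | c , d , p ← node-⇓ t (summary ∘ es) p≤ (λ x → size-summary (es x)) =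
      _ , case-cons (var _) (case-cons (var _) (case-cons (var _) (case-cons (var _) (case-cons (var _)
            (case-cons (var _) (invoke-⇓ nodeF
              (var _ ∷ (var _ ∷ (var _ ∷ (call-solveList {a = # 12} {3F} refl refl d₁ ∷ [])))) d)))))) ,
      substitute-cost 2≤p {l = total (leaves ∘ es)} p p₁

    overhead : ∀ c {i} → i ≤ 3 → 8 + (c + i) ≤ c + Q
    overhead c {i} i≤3 = begin
      8 + (c + i)   ≡⟨ arrange c i ⟩
      c + (8 + i)   ≤⟨ +-monoʳ-≤ c (≤-trans (+-monoʳ-≤ 8 i≤3) (≤-trans (m≤m+n 11 89) (m≤n+m 100 F))) ⟩
      c + Q         ∎
      where
      open ≤-Reasoning
      arrange : ∀ c i → 8 + (c + i) ≡ c + (8 + i)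
      arrange = solve-∀

    solve-⇓ : ∀ (e : Expr k) name → width e ≤ w → Solved e name
    solve-⇓ vertex                name h = solve-vertex name
    solve-⇓ (union e₁ e₂)         name h = solve-union e₁ e₂ name
      (solve-⇓ e₁ (name ∘ inj₁) (≤-trans (m≤m⊔n (width e₁) (width e₂)) h))
      (solve-⇓ e₂ (name ∘ inj₂) (≤-trans (m≤n⊔m (width e₁) (width e₂)) h))
    solve-⇓ (join L e₁ e₂)        name h = solve-join L e₁ e₂ name
      (solve-⇓ e₁ (name ∘ inj₁) (≤-trans (m≤m⊔n (width e₁) (width e₂)) h))
      (solve-⇓ e₂ (name ∘ inj₂) (≤-trans (m≤n⊔m (width e₁) (width e₂)) h))
    solve-⇓ (substitute {p} 2≤p t loopless es) name h = solve-substitute 2≤p t loopless es name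
      (≤-trans (⊥≤max p (List.tabulate (width ∘ es))) (≤-trans h (≤-trans (m≤n+m w k) (m≤m+n (k + w) 2))))
      (λ x → solve-⇓ (es x) (λ u → name (x , u))
        (≤-trans (All.lookup (xs≤max p (List.tabulate (width ∘ es))) (∈-tabulate⁺ x)) h))

    main-⇓ : ∀ (e : Expr k) name {rest} → width e ≤ w →
             ∃[ b ] ∃[ c ] (((encodeℕ k ∙ rest) ∙ encodeExpr e name) ∷ [] ⊢ mainBody ⇓ encodeBool b cost c) ×
                           c ≤ leaves e * (Q + Q) × (IsTrue (summary e) ⇔ T b)
    main-⇓ e name h with summary e | solve-⇓ e name h
    ... | nil   | c , d , p =
      false , _ ,
      case-cons (var _) (case-cons (var _) (case-nil (call-solve {a = 0F} {3F} refl refl d) nil)) ,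
      ≤-trans (overhead c (s≤s z≤n)) p , mk⇔ id id
    ... | _ ∙ _ | c , d , p =
      true , _ ,
      case-cons (var _) (case-cons (var _) (case-cons (call-solve {a = 0F} {3F} refl refl d) (nil ∙ nil))) ,
      ≤-trans (overhead c ≤-refl) p , mk⇔ id id

-- The decision program

-- The two `comp`s give `vertexPR` and `nodePR` function symbols in one assembled program, where the
-- recursion over expressions can call them.
summaries : PR 0
summaries = comp vertexPR (nil ∷ nil ∷ nil ∷ nil ∷ []) ∙ comp nodePR (nil ∷ nil ∷ nil ∷ nil ∷ [])

open Assembly summaries

private
  solve solveList : Func arity 2
  solve     = 1F , refl
  solveList = 2F , refl

  vertexF nodeF : Func arity 4
  vertexF = slot (inj₁ nothing)
  nodeF   = slot (inj₂ nothing)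

open Solver arity equal solve solveList vertexF nodeF

decider : Program
decider = program solveBody solveListBody mainBody

open Linking solveBody solveListBody mainBody

module _ {k w : ℕ} where

  private
    F : ℕ
    F = at callB (k + w)

    vertex-⇓ : ∃[ c ] (encodeℕ k ∷ nil ∷ nil ∷ nil ∷ [] ⊢ bodyOf vertexF ⇓ summary {k} vertex cost c) × c ≤ F
    vertex-⇓ =
      let c , d , p , _ = evaluate refl vertexPR (slot ∘ inj₁ ∘ just ∘ inj₁) (linked ∘ inj₁ ∘ just ∘ inj₁)
                            (size-vertex-arguments (m≤m+n k w))
      in c , subst (λ b → (encodeℕ k ∷ nil ∷ nil ∷ nil ∷ []) ⊢ b ⇓ summary {k} vertex cost c)
               (sym (linked (inj₁ nothing))) d ,
         ≤-trans p (vertex≤call (k + w))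

    node-⇓ : ∀ {p} (t : Fin p → Fin p → Maybe (LabelSet k)) S →
             p ≤ k + w + 2 → (∀ x → size (S x) ≤ at summaryB k) →
             ∃[ c ] (encodeℕ k ∷ encodeℕ p ∷ encodeTemplate t ∷ encodeList (List.tabulate S) ∷ []
                       ⊢ bodyOf nodeF ⇓ node t S cost c) × c ≤ F
    node-⇓ {p} t S p≤ h =
      let c , d , c≤ , _ = evaluate refl nodePR (slot ∘ inj₂ ∘ just ∘ inj₁) (linked ∘ inj₂ ∘ just ∘ inj₁)
                            (size-arguments (m≤m+n k w) t S p≤ h)
      in c , subst (λ b → (encodeℕ k ∷ encodeℕ p ∷ encodeTemplate t ∷ encodeList (List.tabulate S) ∷ [])
                            ⊢ b ⇓ node t S cost c) (sym (linked (inj₂ nothing))) d ,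
         ≤-trans c≤ (node≤call (k + w))

  open SolverCost decider equal solve solveList vertexF nodeF

  decider-⇓ : ∀ (e : Expr k) name {rest} → width e ≤ w →
              ∃[ b ] ∃[ c ] Run decider ((encodeℕ k ∙ rest) ∙ encodeExpr e name) (encodeBool b) c ×
                            c ≤ leaves e * at timeB (k + w) × (IsTrue (summary e) ⇔ T b)
  decider-⇓ = main-⇓ refl refl vertex-⇓ node-⇓

decides : ∀ {k n} (I : Instance k n) (D : Decomposition (labeledUnion I)) →
          DecidesWithin decider (encodeInput I D) (CompatibleOrdering I)
            (at timeB (k + decompositionWidth D) * n ^ 1)
decides {k} {n} I D =
  let b , c , run , c≤ , correct = decider-⇓ {w = width expr} expr (toℕ ∘ name) ≤-refl
  in b , c , run , subst (c ≤_) (time (at timeB (k + width expr))) c≤ ,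
     mk⇔ (to correct ∘ to (summary-correct I D)) (from (summary-correct I D) ∘ from correct)
  where
  open Decomposition D
  time : ∀ T → leaves expr * T ≡ T * n ^ 1
  time T = trans (*-comm (leaves expr) T)
    (cong (T *_) (trans (↔⇒≡ (↔-trans (leaves-vertices expr) vertices)) (sym (^-identityʳ n))))

theorem5 : (∃[ f ] Computable f × (∃[ P ] ∃[ c ]
    (∀ {k n} → 1 ≤ k → (I : Instance k n) (D : Decomposition (labeledUnion I)) →
    DecidesWithin P (encodeInput I D) (CompatibleOrdering I)
    (f (k + decompositionWidth D) * n ^ c))))
    ×
    (∀ (b : ℕ) → ∃[ P ] ∃[ C ] ∃[ c ]
    (∀ {k n} → 1 ≤ k → (I : Instance k n) (D : Decomposition (labeledUnion I)) →
    k + decompositionWidth D ≤ b →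
    DecidesWithin P (encodeInput I D) (CompatibleOrdering I)
    (C * n ^ c)))
theorem5 =
  (at timeB , computable timeB , decider , 1 , λ _ → decides) ,
  -- The same program serves every b; monotonicity of the time bound turns it into a constant.
  λ b → decider , at timeB b , 1 , λ {_} {n} _ I D k+w≤b →
    let answer , t , run , t≤ , correct = decides I D
    in answer , t , run , ≤-trans t≤ (*-monoˡ-≤ (n ^ 1) (mono timeB k+w≤b)) , correct
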